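{- Let $\mathcal E=\{p_1,\dots,p_n\}\subseteq\mathbb K[x,y_1,\dots,y_n]$ be a set of $n$ polynomials, regarded as a vector. Let $\bar r_0\in\mathbb K^n$ be such that $\mathcal E(0,\bar r_0)=0$ and the matrix $(\nabla^{\eth}_{\bar y}\mathcal E)(0,\bar r_0,\bar r_0)\in\mathbb K^{n\times n}$ is invertible. Then there is a unique stream solution $\bar\sigma\in\Sigma^n$ of $\mathcal E$ with $\bar\sigma(0)=\bar r_0$. Moreover, $(\nabla^{\eth}_{\bar y}\mathcal E)(X,\bar r_0,\bar\sigma)$ is invertible in $\Sigma^{n\times n}$ and $\bar\sigma$ satisfies $$\bar\sigma'^{T}=-\big(\nabla^{\eth}_{\bar y}\mathcal E\big)(X,\bar r_0,\bar\sigma)^{ -1}\cdot\Big(\frac{\eth\mathcal E}{\eth x}(X,\bar\sigma)\Big)^{T},\qquad \bar\sigma(0)=\bar r_0.$$ Furthermore, there exist polynomials $P_1,\dots,P_{n+1}\in\mathbb K[x,y_1,\dots,y_n,w]$ (with $w$ a new variable) and an initial value $c\in\mathbb K$, constructed from $\mathcal E$ and $\bar r_0$, such that the polynomial stream differential equation initial value problem $y_i'=P_i$, $y_i(0)=r_{0i}$ ($i=1,\dots,n$), $w'=P_{n+1}$, $w(0)=c$ has as unique solution $(\bar\sigma,\tau)$ for a suitable stream $\tau$.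
   Context: $\mathbb K$ is a field of characteristic $0$; streams $\Sigma=\mathbb K^\omega$ with pointwise sum, convolution product $(\sigma\times\tau)(i)=\sum_{j=0}^{i}\sigma(j)\tau(i-j)$, scalars identified with $(r,0,0,\dots)$, $X=(0,1,0,\dots)$, stream derivative $\sigma'(i)=\sigma(i+1)$. A stream solution of $\mathcal E$ is $\bar\sigma\in\Sigma^n$ with $p(X,\bar\sigma)=0$ for all $p\in\mathcal E$ ($x\mapsto X$, $y_i\mapsto\sigma_i$). A solution of a polynomial stream differential equation initial value problem $y_i'=P_i$, $y_i(0)=r_i$ is a tuple of streams $\bar\sigma$ with $\sigma_i'=P_i(X,\bar\sigma)$, $\sigma_i(0)=r_i$. Syntactic stream derivative of $p\in\mathbb K[x,\bar y]$: with new indeterminates $y_{0i},y_i'$, $y_0:=x$, $y_{00}:=0$, total order $y_0<y_1<\dots<y_n$, $\min(m)$ the least variable in monomial $m\ne1$: $(1)'=0$, $(x)'=1$, $(y_i)'=y_i'$, $(y_im)'=y_i'm+y_{0i}(m)'$ when $m\ne1$ and $y_i=\min(y_im)$, extended linearly. Writing uniquely $p'=q_0+\sum_{i=1}^nq_iy_i'$ with $q_j\in\mathbb K[x,\bar y_0,\bar y]$, set $\frac{\eth p}{\eth x}:=q_0$ (lies in $\mathbb K[x,\bar y]$) and $\frac{\eth p}{\eth y_i}:=q_i$. $\nabla^{\eth}_{\bar y}\mathcal E$ is the $n\times n$ polynomial matrix with entries $\frac{\eth p_i}{\eth y_j}$, and $\frac{\eth\mathcal E}{\eth x}=(\frac{\eth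 p_1}{\eth x},\dots,\frac{\eth p_n}{\eth x})$. $(\nabla^{\eth}_{\bar y}\mathcal E)(0,\bar r_0,\bar r_0)$ means evaluation at $x=0$, $\bar y_0=\bar r_0$, $\bar y=\bar r_0$; evaluation at $(X,\bar r_0,\bar\sigma)$ substitutes $x\mapsto X$, $y_{0i}\mapsto r_{0i}$, $y_i\mapsto\sigma_i$. -}

module Defs where

open import Algebra.Apartness.Bundles using (HeytingField; HeytingCommutativeRing)
open import Algebra.Bundles using (CommutativeRing)
open import Algebra.Bundles.Raw using (RawRing)
import Algebra.Definitions
import Algebra.Definitions.RawSemiring
open import Data.Bool.Base using (if_then_else_)
open import Data.Fin.Base using (Fin; zero; suc; toℕ; _↑ˡ_; _↑ʳ_)
import Data.Fin.Properties as Fin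
open import Data.List.Base using (List; []; _∷_; [_]; concat; concatMap; cartesianProductWith; filter; foldr; map; replicate; tabulate) renaming (_++_ to _++ˡ_)
open import Data.List.Relation.Unary.All as All using (All; []; _∷_)
import Data.List.Relation.Unary.All.Properties as All
open import Data.Nat.Base as ℕ using (ℕ; zero; suc; _∸_)
import Data.Nat.Properties as ℕ
open import Data.Product.Base using (_,_; _×_; map₂; proj₂; ∃-syntax)
open import Data.Sum.Base using (_⊎_; inj₁; inj₂)
open import Data.Vec.Base as Vec using (Vec)
import Data.Vec.Properties as Vec
open import Data.Vec.Functional using (Vector) renaming (_∷_ to _◂_; _++_ to _⊕_)
open import Data.Vec.Functional.Relation.Binary.Pointwise using (Pointwise)
open import Level using (_⊔_)
open import Relation.Binary.PropositionalEquality using (_≡_; refl; trans; cong; cong₂; module ≡-Reasoning)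
open import Relation.Nullary.Decidable using (does)
open import Relation.Nullary.Negation using (¬_)

fieldRawRing : ∀ {c ℓ₁ ℓ₂} → HeytingField c ℓ₁ ℓ₂ → RawRing c ℓ₁
fieldRawRing K = CommutativeRing.rawRing (HeytingCommutativeRing.commutativeRing (HeytingField.heytingCommutativeRing K))

CharacteristicZero : ∀ {c ℓ₁ ℓ₂} → HeytingField c ℓ₁ ℓ₂ → Set ℓ₁
CharacteristicZero K = ∀ n → ¬ (suc n ×ⁿ 1#) ≈ 0#
  where
  open RawRing (fieldRawRing K)
  open Algebra.Definitions.RawSemiring rawSemiring using () renaming (_×_ to _×ⁿ_)

module Matrices {a ℓ} (R : RawRing a ℓ) where
  open RawRing R
  open Algebra.Definitions.RawSemiring rawSemiring using (sum)

  Matrix : ℕ → Set a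
  Matrix n = Vector (Vector Carrier n) n

  _≈ᴹ_ : ∀ {n} → Matrix n → Matrix n → Set ℓ
  _≈ᴹ_ = Pointwise (Pointwise _≈_)

  1ᴹ : ∀ {n} → Matrix n
  1ᴹ i j = if does (i Fin.≟ j) then 1# else 0#

  _*ᴹ_ : ∀ {n} → Matrix n → Matrix n → Matrix n
  (M *ᴹ N) i k = sum λ j → M i j * N j k

  _*ⱽ_ : ∀ {n} → Matrix n → Vector Carrier n → Vector Carrier n
  (M *ⱽ v) i = sum λ j → M i j * v j

  InvertibleMatrix : ∀ {n} → Matrix n → Set (a ⊔ ℓ)
  InvertibleMatrix = Algebra.Definitions.Invertible _≈ᴹ_ 1ᴹ _*ᴹ_

module StreamCalculus {c ℓ₁ ℓ₂} (K : HeytingField c ℓ₁ ℓ₂) where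
  private
    module K = RawRing (fieldRawRing K)
    module KΣ = Algebra.Definitions.RawSemiring K.rawSemiring

  Stream : Set c
  Stream = ℕ → K.Carrier

  const : K.Carrier → Stream
  const r zero    = r
  const r (suc _) = K.0#

  X : Stream
  X zero          = K.0#
  X (suc zero)    = K.1#
  X (suc (suc _)) = K.0#

  _′ : Stream → Stream
  (σ ′) i = σ (suc i)

  streamRawRing : RawRing c ℓ₁
  streamRawRing = record
    { Carrier = Stream
    ; _≈_     = λ σ τ → ∀ i → σ i K.≈ τ i
    ; _+_     = λ σ τ i → σ i K.+ τ i
    ; _*_     = λ σ τ i → KΣ.sum {suc i} λ j → σ (toℕ j) K.* τ (i ∸ toℕ j)
    ; -_      = λ σ i → K.- σ i
    ; 0#      = const K.0#
    ; 1#      = const K.1#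
    }

  open RawRing streamRawRing public using () renaming (_≈_ to _≈ˢ_; -_ to -ˢ_)
  open Matrices (fieldRawRing K) public using () renaming (InvertibleMatrix to InvertibleMatrixᴷ)
  open Matrices streamRawRing public using () renaming (InvertibleMatrix to InvertibleMatrixˢ; _*ⱽ_ to _*ˢⱽ_)

  -- Polynomials in m indeterminates, as formal sums of terms (coefficient,
  -- exponent vector). Terms may repeat a monomial or have coefficient 0; all
  -- operations below are linear in the terms, hence independent of the chosen
  -- representative.
  Monomial : ℕ → Set
  Monomial = Vec ℕ

  Poly : ℕ → Set c
  Poly m = List (K.Carrier × Monomial m)

  1ᵐ : ∀ {m} → Monomial m
  1ᵐ = Vec.replicate _ 0

  varᵐ : ∀ {m} → Fin m → Monomial m
  varᵐ i = 1ᵐ Vec.[ i ]≔ 1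

  0ᵖ 1ᵖ : ∀ {m} → Poly m
  0ᵖ = []
  1ᵖ = [ K.1# , 1ᵐ ]

  var : ∀ {m} → Fin m → Poly m
  var i = [ K.1# , varᵐ i ]

  _+ᵖ_ _*ᵖ_ : ∀ {m} → Poly m → Poly m → Poly m
  _+ᵖ_ = _++ˡ_
  _*ᵖ_ = cartesianProductWith λ (a , μ) (b , ν) → a K.* b , Vec.zipWith ℕ._+_ μ ν

  _·ᵖ_ : ∀ {m} → K.Carrier → Poly m → Poly m
  a ·ᵖ p = map (λ (b , μ) → a K.* b , μ) p

  module Evaluation {a ℓ} (R : RawRing a ℓ) (ι : K.Carrier → RawRing.Carrier R) where
    open RawRing R
    open Algebra.Definitions.RawSemiring rawSemiring using (product; _^_)

    ⟦_⟧ : ∀ {m} → Poly m → Vector Carrier m → Carrier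
    ⟦ p ⟧ ρ = foldr (λ (a , μ) s → ι a * product (λ i → ρ i ^ Vec.lookup μ i) + s) 0# p

  open K public using (Carrier; _≈_; 0#)
  open Evaluation (fieldRawRing K) (λ r → r) public using () renaming (⟦_⟧ to ⟦_⟧ᴷ)
  open Evaluation streamRawRing const public using () renaming (⟦_⟧ to ⟦_⟧ˢ)

  -- The coefficient of the monomial ν in the last k indeterminates, a
  -- polynomial in the first m.
  coeff : ∀ {m k} → Monomial k → Poly (m ℕ.+ k) → Poly m
  coeff {m} ν p = map (map₂ (Vec.take m)) (filter (λ t → Vec.≡-dec ℕ._≟_ (Vec.drop m (proj₂ t)) ν) p)

  -- The indeterminates are ordered as follows:
  --   K[x,y]        x , y₁ … yₙ
  --   K[x,y₀,y]     x , y₁ … yₙ , y₀₁ … y₀ₙ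
  --   K[x,y₀,y,y′]  x , y₁ … yₙ , y₀₁ … y₀ₙ , y₁′ … yₙ′
  module _ {n : ℕ} where

    PolyXY PolyXY₀Y PolyXY₀YY′ : Set c
    PolyXY     = Poly (suc n)
    PolyXY₀Y   = Poly (suc n ℕ.+ n)
    PolyXY₀YY′ = Poly (suc n ℕ.+ n ℕ.+ n)

    -- The assignment to the indeterminates of K[x,y₀,y] written (x , y₀ , y).
    ⟨_,_,_⟩ : ∀ {a} {A : Set a} → A → Vector A n → Vector A n → Vector A (suc n ℕ.+ n)
    ⟨ x , y₀ , y ⟩ = (x ◂ y) ⊕ y₀

    -- vᵢ, its initial value and its derivative, where v₀ = x, vᵢ = yᵢ: the cases
    -- at zero are the conventions y₀₀ = 0 and x′ = 1.
    base initial derived : Fin (suc n) → PolyXY₀YY′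
    base i          = var ((i ↑ˡ n) ↑ˡ n)
    initial zero    = 0ᵖ
    initial (suc i) = var ((suc n ↑ʳ i) ↑ˡ n)
    derived zero    = 1ᵖ
    derived (suc i) = var ((suc n ℕ.+ n) ↑ʳ i)

    -- A monomial as the increasing list of its variables with multiplicity,
    -- whose head is therefore its least variable.
    word : Monomial (suc n) → List (Fin (suc n))
    word μ = concat (tabulate λ i → replicate (Vec.lookup μ i) i)

    derivWord : List (Fin (suc n)) → PolyXY₀YY′
    derivWord []              = 0ᵖ
    derivWord (v ∷ [])        = derived v
    derivWord (v ∷ m@(_ ∷ _)) = (derived v *ᵖ foldr (λ u q → base u *ᵖ q) 1ᵖ m) +ᵖ (initial v *ᵖ derivWord m)

    deriv : PolyXY → PolyXY₀YY′
    deriv = concatMap λ (a , μ) → a ·ᵖ derivWord (word μ)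

    -- q₀ and qᵢ in the decomposition p′ = q₀ + Σᵢ qᵢ yᵢ′; see deriv-shape.
    q₀ : PolyXY → PolyXY₀Y
    q₀ p = coeff 1ᵐ (deriv p)

    ð/ðy : Fin n → PolyXY → PolyXY₀Y
    ð/ðy i p = coeff (varᵐ i) (deriv p)

    -- q₀ as an element of K[x,y]; by deriv-shape it does not involve y₀.
    ð/ðx : PolyXY → PolyXY
    ð/ðx p = coeff 1ᵐ (q₀ p)

    ∇ : Vector PolyXY n → Vector (Vector PolyXY₀Y n) n
    ∇ E i j = ð/ðy j (E i)

    private
      NoY′ NoY₀ : Monomial (suc n ℕ.+ n ℕ.+ n) → Set
      NoY′ μ = Vec.drop (suc n ℕ.+ n) μ ≡ 1ᵐ
      NoY₀ μ = Vec.drop (suc n) (Vec.take (suc n ℕ.+ n) μ) ≡ 1ᵐ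

      Y′Is : Fin n → Monomial (suc n ℕ.+ n ℕ.+ n) → Set
      Y′Is i μ = Vec.drop (suc n ℕ.+ n) μ ≡ varᵐ i

      Linear : Monomial (suc n ℕ.+ n ℕ.+ n) → Set
      Linear μ = ∃[ i ] Y′Is i μ

      NonMin : Fin (suc n) → Set
      NonMin v = ∃[ i ] v ≡ suc i

      drop-1ᵐ : ∀ m {k} → Vec.drop m {k} 1ᵐ ≡ 1ᵐ
      drop-1ᵐ zero    = refl
      drop-1ᵐ (suc m) = drop-1ᵐ m

      take-1ᵐ : ∀ m {k} → Vec.take m {k} 1ᵐ ≡ 1ᵐ
      take-1ᵐ zero    = refl
      take-1ᵐ (suc m) = cong (0 Vec.∷_) (take-1ᵐ m)

      drop-varᵐ-↑ˡ : ∀ m {k} (i : Fin m) → Vec.drop m (varᵐ (i ↑ˡ k)) ≡ 1ᵐ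
      drop-varᵐ-↑ˡ (suc m) zero    = drop-1ᵐ m
      drop-varᵐ-↑ˡ (suc m) (suc i) = drop-varᵐ-↑ˡ m i

      drop-varᵐ-↑ʳ : ∀ m {k} (i : Fin k) → Vec.drop m (varᵐ (m ↑ʳ i)) ≡ varᵐ i
      drop-varᵐ-↑ʳ zero    i = refl
      drop-varᵐ-↑ʳ (suc m) i = drop-varᵐ-↑ʳ m i

      take-varᵐ-↑ˡ : ∀ m {k} (i : Fin m) → Vec.take m (varᵐ (i ↑ˡ k)) ≡ varᵐ i
      take-varᵐ-↑ˡ (suc m) zero    = cong (1 Vec.∷_) (take-1ᵐ m)
      take-varᵐ-↑ˡ (suc m) (suc i) = cong (0 Vec.∷_) (take-varᵐ-↑ˡ m i)

      +-1ᵐˡ : ∀ {m} (μ : Monomial m) → Vec.zipWith ℕ._+_ 1ᵐ μ ≡ μ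
      +-1ᵐˡ = Vec.zipWith-identityˡ ℕ.+-identityˡ

      +-1ᵐʳ : ∀ {m} (μ : Monomial m) → Vec.zipWith ℕ._+_ μ 1ᵐ ≡ μ
      +-1ᵐʳ = Vec.zipWith-identityʳ ℕ.+-identityʳ

      Y′-* : ∀ (μ ν : Monomial (suc n ℕ.+ n ℕ.+ n)) → Vec.drop (suc n ℕ.+ n) (Vec.zipWith ℕ._+_ μ ν) ≡ Vec.zipWith ℕ._+_ (Vec.drop (suc n ℕ.+ n) μ) (Vec.drop (suc n ℕ.+ n) ν)
      Y′-* = Vec.drop-zipWith {m = suc n ℕ.+ n} ℕ._+_

      noY′-* : ∀ μ ν → NoY′ μ → NoY′ ν → NoY′ (Vec.zipWith ℕ._+_ μ ν)
      noY′-* μ ν p q = trans (Y′-* μ ν) (trans (cong₂ (Vec.zipWith ℕ._+_) p q) (+-1ᵐˡ 1ᵐ))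

      noY₀-* : ∀ μ ν → NoY₀ μ → NoY₀ ν → NoY₀ (Vec.zipWith ℕ._+_ μ ν)
      noY₀-* μ ν p q = begin
        Vec.drop (suc n) (Vec.take (suc n ℕ.+ n) (Vec.zipWith ℕ._+_ μ ν))
          ≡⟨ cong (Vec.drop (suc n)) (Vec.take-zipWith {m = suc n ℕ.+ n} ℕ._+_ μ ν) ⟩
        Vec.drop (suc n) (Vec.zipWith ℕ._+_ (Vec.take (suc n ℕ.+ n) μ) (Vec.take (suc n ℕ.+ n) ν))
          ≡⟨ Vec.drop-zipWith {m = suc n} ℕ._+_ (Vec.take (suc n ℕ.+ n) μ) (Vec.take (suc n ℕ.+ n) ν) ⟩
        Vec.zipWith ℕ._+_ (Vec.drop (suc n) (Vec.take (suc n ℕ.+ n) μ)) (Vec.drop (suc n) (Vec.take (suc n ℕ.+ n) ν))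
          ≡⟨ cong₂ (Vec.zipWith ℕ._+_) p q ⟩
        Vec.zipWith ℕ._+_ 1ᵐ 1ᵐ
          ≡⟨ +-1ᵐˡ 1ᵐ ⟩
        1ᵐ ∎
        where open ≡-Reasoning

      AllM : (Monomial (suc n ℕ.+ n ℕ.+ n) → Set) → PolyXY₀YY′ → Set c
      AllM P = All (λ t → P (proj₂ t))

      all-* : ∀ {P Q R} → (∀ μ ν → P μ → Q ν → R (Vec.zipWith ℕ._+_ μ ν)) →
              ∀ {p q} → AllM P p → AllM Q q → AllM R (p *ᵖ q)
      all-* f []         qs = []
      all-* f (px ∷ ps) qs = All.++⁺ (All.map⁺ (All.map (f _ _ px) qs)) (all-* f ps qs)

      Base : Monomial (suc n ℕ.+ n ℕ.+ n) → Set
      Base μ = NoY₀ μ × NoY′ μ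

      base-* : ∀ μ ν → Base μ → Base ν → Base (Vec.zipWith ℕ._+_ μ ν)
      base-* μ ν (p₁ , p₂) (q₁ , q₂) = noY₀-* μ ν p₁ q₁ , noY′-* μ ν p₂ q₂

      1-base : Base 1ᵐ
      1-base = trans (cong (Vec.drop (suc n)) (take-1ᵐ (suc n ℕ.+ n))) (drop-1ᵐ (suc n)) , drop-1ᵐ (suc n ℕ.+ n)

      base-base : ∀ v → AllM Base (base v)
      base-base v = (trans (cong (Vec.drop (suc n)) (take-varᵐ-↑ˡ (suc n ℕ.+ n) (v ↑ˡ n))) (drop-varᵐ-↑ˡ (suc n) v) , drop-varᵐ-↑ˡ (suc n ℕ.+ n) (v ↑ˡ n)) ∷ []

      word-base : ∀ w → AllM Base (foldr (λ u q → base u *ᵖ q) 1ᵖ w)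
      word-base []      = 1-base ∷ []
      word-base (v ∷ w) = all-* base-* (base-base v) (word-base w)

      linear-base : ∀ μ ν → Linear μ → Base ν → Linear (Vec.zipWith ℕ._+_ μ ν)
      linear-base μ ν (i , p) (_ , q) = i , trans (Y′-* μ ν) (trans (cong₂ (Vec.zipWith ℕ._+_) p q) (+-1ᵐʳ _))

      noY′-linear : ∀ μ ν → NoY′ μ → Linear ν → Linear (Vec.zipWith ℕ._+_ μ ν)
      noY′-linear μ ν p (i , q) = i , trans (Y′-* μ ν) (trans (cong₂ (Vec.zipWith ℕ._+_) p q) (+-1ᵐˡ _))

      derivWord-linear : ∀ {w} → All NonMin w → AllM Linear (derivWord w)
      derivWord-linear []                               = []
      derivWord-linear ((i , refl) ∷ [])                = (i , drop-varᵐ-↑ʳ (suc n ℕ.+ n) i) ∷ []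
      derivWord-linear {_ ∷ w@(_ ∷ _)} ((i , refl) ∷ ps@(_ ∷ _)) = All.++⁺
        (all-* linear-base ((i , drop-varᵐ-↑ʳ (suc n ℕ.+ n) i) ∷ []) (word-base w))
        (all-* noY′-linear (drop-varᵐ-↑ˡ (suc n ℕ.+ n) (suc n ↑ʳ i) ∷ []) (derivWord-linear ps))

      Shape : Monomial (suc n ℕ.+ n ℕ.+ n) → Set
      Shape μ = Base μ ⊎ Linear μ

      derivWord-shape : ∀ a {w} → All NonMin w → AllM Shape (derivWord (replicate a zero ++ˡ w))
      derivWord-shape zero    ps = All.map inj₂ (derivWord-linear ps)
      derivWord-shape (suc a) {w} ps with replicate a zero ++ˡ w
      ... | []        = inj₁ 1-base ∷ []
      ... | m@(_ ∷ _) = All.++⁺ (All.map inj₁ (all-* base-* (1-base ∷ []) (word-base m))) []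

    -- Every monomial of p′ either contains no y₀ⱼ and no yⱼ′, or contains
    -- exactly one yᵢ′, to the first power.
    deriv-shape : ∀ p → All (λ (_ , μ) →
        (Vec.drop (suc n) (Vec.take (suc n ℕ.+ n) μ) ≡ 1ᵐ × Vec.drop (suc n ℕ.+ n) μ ≡ 1ᵐ)
        ⊎ (∃[ i ] Vec.drop (suc n ℕ.+ n) μ ≡ varᵐ i))
      (deriv p)
    deriv-shape []                    = []
    deriv-shape ((_ , a Vec.∷ μ) ∷ p) = All.++⁺
      (All.map⁺ (derivWord-shape a (All.concat⁺ (All.tabulate⁺ λ i → All.replicate⁺ (Vec.lookup μ i) (i , refl)))))
      (deriv-shape p)

  _≈ˢⱽ_ : ∀ {m} → Vector Stream m → Vector Stream m → Set ℓ₁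
  _≈ˢⱽ_ = Pointwise _≈ˢ_

  HasInitialValue : ∀ {m} → Vector Stream m → Vector K.Carrier m → Set ℓ₁
  HasInitialValue σ r = ∀ i → σ i 0 K.≈ r i

  IsStreamSolution : ∀ {n k} → Vector (Poly (suc n)) k → Vector Stream n → Set ℓ₁
  IsStreamSolution E σ = ∀ i → ⟦ E i ⟧ˢ (X ◂ σ) ≈ˢ const K.0#

  IsIVPSolution : ∀ {m} → Vector (Poly (suc m)) m → Vector K.Carrier m → Vector Stream m → Set ℓ₁
  IsIVPSolution P r σ = (∀ i → (σ i ′) ≈ˢ ⟦ P i ⟧ˢ (X ◂ σ)) × HasInitialValue σ r

{-# OPTIONS --safe #-}

-- Over K[x,y] the matrix A obtained from ∇E by setting y₀ = r₀ has a "scaled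
-- inverse": a matrix N and a polynomial d with N A = A N = d·1 and
-- d(0,r₀) = 1. It comes from fraction-free Gauss–Jordan elimination, after
-- multiplying A by the inverse of A(0,r₀), and replaces adjugate and
-- determinant. With w standing for 1/d, the equation for σ′ becomes
-- y′ = −w N ðE/ðx, and w′ = −w d′ where d′ is expanded by the chain rule; this
-- is the polynomial initial value problem, which has a unique solution because
-- polynomial operations on streams are causal. For its solution, w d and 1
-- satisfy the same affine equation u′ = −d′ u + d′ with u(0) = 1, so w d = 1;
-- hence A is invertible and E(X,σ)′ = 0 by the chain rule. Conversely every
-- stream solution of E, together with w = 1/d, solves the initial value
-- problem, whence uniqueness.
module Submission where

open import Defs
open import Algebra.Apartness.Bundles using (HeytingField; HeytingCommutativeRing)
open import Algebra.Bundles using (CommutativeRing)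
open import Algebra.Bundles.Raw using (RawRing)
import Algebra.Construct.Pointwise
import Algebra.Definitions.RawSemiring
import Algebra.Morphism.Construct.Composition
import Algebra.Morphism.RingMonomorphism
open import Algebra.Morphism.Structures using (IsRingHomomorphism; IsRingMonomorphism)
import Algebra.Properties.CommutativeMonoid.Sum
import Algebra.Properties.CommutativeSemigroup
import Algebra.Properties.Monoid.Mult
import Algebra.Properties.Ring
import Algebra.Properties.Semiring.Sum
open import Data.Bool.Base using (true; false; if_then_else_)
open import Data.Fin.Base using (Fin; zero; suc; toℕ; _↑ˡ_; _↑ʳ_; join; splitAt)
import Data.Fin.Properties as Fin
open import Data.List.Membership.Propositional using (_∈_)
open import Data.List.Membership.Propositional.Properties using (∈-allFin)
import Data.List.Relation.Unary.All.Properties as All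
open import Data.List.Relation.Unary.Any using (here; there)
open import Data.Nat.Base as ℕ using (ℕ; zero; suc; _∸_)
import Data.Nat.Properties as ℕ
open import Data.Product.Base using (Σ-syntax; ∃-syntax; _×_; _,_; proj₁; proj₂)
open import Data.Sum.Base using (_⊎_; inj₁; inj₂)
open import Data.Vec.Base as Vec using (Vec)
open import Data.Vec.Functional using (Vector) renaming ([] to ∅; _∷_ to _◂_; _++_ to _⊕_)
open import Data.Vec.Functional.Properties using (lookup-++ˡ; lookup-++ʳ)
import Data.Vec.Properties as Vec
open import Function.Base using (_∘_)
open import Level as Level using (_⊔_)
open import Relation.Binary.PropositionalEquality as ≡ using (_≡_; _≢_)
import Relation.Binary.Reasoning.Setoid
open import Relation.Nullary.Decidable using (Dec; does; yes; no; dec-true; dec-false)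
open import Relation.Nullary.Negation using (contradiction)

-- Equality in a Heyting field is not assumed decidable, so elimination cannot look for a nonzero
-- pivot by testing entries. Since polynomials cannot be divided, the pivots accumulate in the
-- single denominator `d`. The normalisation of `d` also fixes the constant of the initial value
-- problem. The stream product rule `(στ)′ = σ′τ + σ(0)τ′` is asymmetric; applied to `w d = 1` it
-- produces the factor `w(0)`, which is 1 because `d` starts with 1. A solution of the initial value
-- problem is not known beforehand to satisfy `w d = 1`, although the equations were derived from
-- this relation. It therefore has to be recovered from the equation for `w` before anything can be
-- said about `E`. The algebra is carried out in an abstract `StreamAlgebra`, so that computations
-- with convolution sums remain confined to the construction of one instance.

module RingLemmas {a ℓ} (R : CommutativeRing a ℓ) where
  open CommutativeRing R
  open Algebra.Properties.Ring ring using (-0#≈0#; -‿involutive; -‿+-comm)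
  open Relation.Binary.Reasoning.Setoid setoid

  x-0#≈x : ∀ x → x - 0# ≈ x
  x-0#≈x x = trans (+-congˡ -0#≈0#) (+-identityʳ x)

  x-[x-y]≈y : ∀ x y → x - (x - y) ≈ y
  x-[x-y]≈y x y = begin
    x + - (x + - y)      ≈⟨ +-congˡ (-‿+-comm x (- y)) ⟨
    x + (- x + - (- y))  ≈⟨ +-assoc _ _ _ ⟨
    x + - x + - (- y)    ≈⟨ +-cong (-‿inverseʳ x) (-‿involutive y) ⟩
    0# + y               ≈⟨ +-identityˡ y ⟩
    y                    ∎

-- Matrices over a commutative ring and scaled inverses.

module MatrixProperties {a ℓ} (R : CommutativeRing a ℓ) where
  open CommutativeRing R hiding (zero)
  open Matrices rawRing public
  open Algebra.Properties.Semiring.Sum semiring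
  open Relation.Binary.Reasoning.Setoid setoid

  open Algebra.Properties.CommutativeSemigroup *-commutativeSemigroup using (x∙yz≈y∙xz; x∙yz≈yx∙z)

  infixl 7 _·ᴹ_
  _·ᴹ_ : ∀ {n} → Carrier → Matrix n → Matrix n
  (x ·ᴹ M) i j = x * M i j

  _ᵀ : ∀ {n} → Matrix n → Matrix n
  (M ᵀ) i j = M j i

  1ᴹ-diagonal : ∀ {n} (i : Fin n) → 1ᴹ i i ≡ 1#
  1ᴹ-diagonal zero    = ≡.refl
  1ᴹ-diagonal (suc i) = 1ᴹ-diagonal i

  1ᴹ-offDiagonal : ∀ {n} {i j : Fin n} → i ≢ j → 1ᴹ i j ≡ 0#
  1ᴹ-offDiagonal {i = i} {j} i≢j = ≡.cong (λ b → if b then 1# else 0#) (dec-false (i Fin.≟ j) i≢j)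

  1ᴹ-sym : ∀ {n} (i j : Fin n) → 1ᴹ i j ≡ 1ᴹ j i
  1ᴹ-sym zero    zero    = ≡.refl
  1ᴹ-sym zero    (suc j) = ≡.refl
  1ᴹ-sym (suc i) zero    = ≡.refl
  1ᴹ-sym (suc i) (suc j) = 1ᴹ-sym i j

  -- Serves for matrix products as well: `(M *ᴹ N) i j` unfolds to the product of `M` with column
  -- `j` of `N`, so the facts about `*ⱽ` below double as facts about `*ᴹ`.
  *ⱽ-cong : ∀ {n} {M N : Matrix n} {u v} → M ≈ᴹ N → (∀ j → u j ≈ v j) → ∀ i → (M *ⱽ u) i ≈ (N *ⱽ v) i
  *ⱽ-cong M≈N u≈v i = sum-cong-≋ λ j → *-cong (M≈N i j) (u≈v j)

  1ᴹ-*ⱽ : ∀ {n} (v : Vector Carrier n) i → (1ᴹ *ⱽ v) i ≈ v i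
  1ᴹ-*ⱽ {suc n} v zero = begin
    1# * v zero + sum (λ j → 0# * v (suc j))  ≈⟨ +-cong (*-identityˡ _) (sum-cong-≋ λ j → zeroˡ (v (suc j))) ⟩
    v zero + sum {n} (λ _ → 0#)               ≈⟨ +-congˡ (sum-replicate-zero n) ⟩
    v zero + 0#                               ≈⟨ +-identityʳ _ ⟩
    v zero                                    ∎
  1ᴹ-*ⱽ {suc n} v (suc i) = begin
    0# * v zero + (1ᴹ *ⱽ (λ j → v (suc j))) i  ≈⟨ +-cong (zeroˡ _) (1ᴹ-*ⱽ (λ j → v (suc j)) i) ⟩
    0# + v (suc i)                             ≈⟨ +-identityˡ _ ⟩
    v (suc i)                                  ∎

  *ᴹ-*ⱽ : ∀ {n} (M N : Matrix n) v i → ((M *ᴹ N) *ⱽ v) i ≈ (M *ⱽ (N *ⱽ v)) i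
  *ᴹ-*ⱽ M N v i = begin
    sum (λ k → sum (λ j → M i j * N j k) * v k)    ≈⟨ sum-cong-≋ (λ k → *-distribʳ-sum (v k) (λ j → M i j * N j k)) ⟩
    sum (λ k → sum (λ j → M i j * N j k * v k))    ≈⟨ sum-cong-≋ (λ k → sum-cong-≋ λ j → *-assoc (M i j) (N j k) (v k)) ⟩
    sum (λ k → sum (λ j → M i j * (N j k * v k)))  ≈⟨ ∑-comm (λ k j → M i j * (N j k * v k)) ⟩
    sum (λ j → sum (λ k → M i j * (N j k * v k)))  ≈⟨ sum-cong-≋ (λ j → *-distribˡ-sum (M i j) (λ k → N j k * v k)) ⟨
    sum (λ j → M i j * sum (λ k → N j k * v k))    ∎

  ·ᴹ-*ⱽ : ∀ {n} x (M : Matrix n) v i → ((x ·ᴹ M) *ⱽ v) i ≈ x * (M *ⱽ v) i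
  ·ᴹ-*ⱽ x M v i = begin
    sum (λ j → x * M i j * v j)    ≈⟨ sum-cong-≋ (λ j → *-assoc x (M i j) (v j)) ⟩
    sum (λ j → x * (M i j * v j))  ≈⟨ *-distribˡ-sum x (λ j → M i j * v j) ⟨
    x * (M *ⱽ v) i                 ∎

  *ⱽ-scale : ∀ {n} x (M : Matrix n) v i → (M *ⱽ (λ j → x * v j)) i ≈ x * (M *ⱽ v) i
  *ⱽ-scale x M v i = begin
    sum (λ j → M i j * (x * v j))  ≈⟨ sum-cong-≋ (λ j → x∙yz≈y∙xz (M i j) x (v j)) ⟩
    sum (λ j → x * (M i j * v j))  ≈⟨ *-distribˡ-sum x (λ j → M i j * v j) ⟨
    x * (M *ⱽ v) i                 ∎

  *ᴹ-1ᴹ : ∀ {n} (M : Matrix n) → (M *ᴹ 1ᴹ) ≈ᴹ M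
  *ᴹ-1ᴹ M i j = begin
    sum (λ k → M i k * 1ᴹ k j)  ≈⟨ sum-cong-≋ (λ k → trans (*-comm _ _) (*-congʳ (reflexive (1ᴹ-sym k j)))) ⟩
    (1ᴹ *ⱽ M i) j               ≈⟨ 1ᴹ-*ⱽ (M i) j ⟩
    M i j                       ∎

  ᵀ-*ᴹ : ∀ {n} (M N : Matrix n) → ((M *ᴹ N) ᵀ) ≈ᴹ ((N ᵀ) *ᴹ (M ᵀ))
  ᵀ-*ᴹ M N i j = sum-cong-≋ λ k → *-comm (M j k) (N k i)

  -- N plays the role of the adjugate of M, and d of its determinant.
  IsScaledInverse : ∀ {n} → Matrix n → Carrier → Matrix n → Set ℓ
  IsScaledInverse M d N = (N *ᴹ M) ≈ᴹ (d ·ᴹ 1ᴹ) × (M *ᴹ N) ≈ᴹ (d ·ᴹ 1ᴹ)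

  scaledInverse-cong : ∀ {n} {M M′ N : Matrix n} {d} → M ≈ᴹ M′ → IsScaledInverse M d N → IsScaledInverse M′ d N
  scaledInverse-cong {M = M} {M′} {N} M≈M′ (left , right) =
    (λ i j → trans (*ⱽ-cong {M = N} (λ _ _ → refl) (λ k → sym (M≈M′ k j)) i) (left i j)) ,
    (λ i j → trans (*ⱽ-cong {M = M′} {M} (λ k l → sym (M≈M′ k l)) (λ _ → refl) i) (right i j))

  -- Computing `N₁ M N₂` in two ways gives `d₁ N₂ = d₂ N₁`, the scaled form of the argument that a
  -- left and a right inverse coincide. Nothing is cancelled, so zero divisors do no harm.
  scaledInverse-combine : ∀ {n} {M N₁ N₂ : Matrix n} {d₁ d₂} →
    (N₁ *ᴹ M) ≈ᴹ (d₁ ·ᴹ 1ᴹ) → (M *ᴹ N₂) ≈ᴹ (d₂ ·ᴹ 1ᴹ) → IsScaledInverse M (d₁ * d₂) (d₁ ·ᴹ N₂)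
  scaledInverse-combine {M = M} {N₁} {N₂} {d₁} {d₂} left right = leftᵖ , rightᵖ
    where
    swap : (d₁ ·ᴹ N₂) ≈ᴹ (d₂ ·ᴹ N₁)
    swap i j = begin
      d₁ * N₂ i j                            ≈⟨ *-congˡ (1ᴹ-*ⱽ (λ k → N₂ k j) i) ⟨
      d₁ * (1ᴹ *ᴹ N₂) i j                    ≈⟨ ·ᴹ-*ⱽ d₁ 1ᴹ (λ k → N₂ k j) i ⟨
      ((d₁ ·ᴹ 1ᴹ) *ᴹ N₂) i j                 ≈⟨ *ⱽ-cong {N = d₁ ·ᴹ 1ᴹ} left (λ _ → refl) i ⟨
      ((N₁ *ᴹ M) *ᴹ N₂) i j                  ≈⟨ *ᴹ-*ⱽ N₁ M (λ k → N₂ k j) i ⟩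
      (N₁ *ᴹ (M *ᴹ N₂)) i j                  ≈⟨ *ⱽ-cong {M = N₁} (λ _ _ → refl) (λ k → right k j) i ⟩
      (N₁ *ᴹ (d₂ ·ᴹ 1ᴹ)) i j                 ≈⟨ *ⱽ-scale d₂ N₁ (λ k → 1ᴹ k j) i ⟩
      d₂ * (N₁ *ᴹ 1ᴹ) i j                    ≈⟨ *-congˡ (*ᴹ-1ᴹ N₁ i j) ⟩
      d₂ * N₁ i j                            ∎
    leftᵖ : ((d₁ ·ᴹ N₂) *ᴹ M) ≈ᴹ (d₁ * d₂ ·ᴹ 1ᴹ)
    leftᵖ i j = begin
      ((d₁ ·ᴹ N₂) *ᴹ M) i j  ≈⟨ *ⱽ-cong {N = d₂ ·ᴹ N₁} swap (λ _ → refl) i ⟩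
      ((d₂ ·ᴹ N₁) *ᴹ M) i j  ≈⟨ ·ᴹ-*ⱽ d₂ N₁ (λ k → M k j) i ⟩
      d₂ * (N₁ *ᴹ M) i j     ≈⟨ *-congˡ (left i j) ⟩
      d₂ * (d₁ * 1ᴹ i j)     ≈⟨ x∙yz≈yx∙z d₂ d₁ (1ᴹ i j) ⟩
      d₁ * d₂ * 1ᴹ i j       ∎
    rightᵖ : (M *ᴹ (d₁ ·ᴹ N₂)) ≈ᴹ (d₁ * d₂ ·ᴹ 1ᴹ)
    rightᵖ i j = begin
      (M *ᴹ (d₁ ·ᴹ N₂)) i j  ≈⟨ *ⱽ-scale d₁ M (λ k → N₂ k j) i ⟩
      d₁ * (M *ᴹ N₂) i j     ≈⟨ *-congˡ (right i j) ⟩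
      d₁ * (d₂ * 1ᴹ i j)     ≈⟨ *-assoc _ _ _ ⟨
      d₁ * d₂ * 1ᴹ i j       ∎

  scaledInverse-invertible : ∀ {n} {M N : Matrix n} {d} e → e * d ≈ 1# → IsScaledInverse M d N →
    ((e ·ᴹ N) *ᴹ M) ≈ᴹ 1ᴹ × (M *ᴹ (e ·ᴹ N)) ≈ᴹ 1ᴹ
  scaledInverse-invertible {M = M} {N} {d} e ed≈1 (left , right) =
    (λ i j → trans (·ᴹ-*ⱽ e N (λ k → M k j) i) (trans (*-congˡ (left i j)) (cancel i j))) ,
    (λ i j → trans (*ⱽ-scale e M (λ k → N k j) i) (trans (*-congˡ (right i j)) (cancel i j)))
    where
    cancel : ∀ i j → e * (d * 1ᴹ i j) ≈ 1ᴹ i j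
    cancel i j = trans (sym (*-assoc _ _ _)) (trans (*-congʳ ed≈1) (*-identityˡ _))

  -- From `A₀ B = 1` follows `A = A₀ (B A)`. Hence `A N B = A₀ (B A N) B = d A₀ B = d`, which is the
  -- side that mere reassociation does not give.
  scaledInverse-*ᴹ : ∀ {n} {A A₀ B N : Matrix n} {d} → (A₀ *ᴹ B) ≈ᴹ 1ᴹ →
    IsScaledInverse (B *ᴹ A) d N → IsScaledInverse A d (N *ᴹ B)
  scaledInverse-*ᴹ {A = A} {A₀} {B} {N} {d} A₀B≈1 (left , right) = left′ , right′
    where
    left′ : ((N *ᴹ B) *ᴹ A) ≈ᴹ (d ·ᴹ 1ᴹ)
    left′ i j = trans (*ᴹ-*ⱽ N B (λ k → A k j) i) (left i j)
    A≈ : ∀ v i → (A *ⱽ v) i ≈ (A₀ *ⱽ ((B *ᴹ A) *ⱽ v)) i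
    A≈ v i = begin
      (A *ⱽ v) i                   ≈⟨ 1ᴹ-*ⱽ (A *ⱽ v) i ⟨
      (1ᴹ *ⱽ (A *ⱽ v)) i           ≈⟨ *ⱽ-cong {N = 1ᴹ} A₀B≈1 (λ _ → refl) i ⟨
      ((A₀ *ᴹ B) *ⱽ (A *ⱽ v)) i    ≈⟨ *ᴹ-*ⱽ A₀ B (A *ⱽ v) i ⟩
      (A₀ *ⱽ (B *ⱽ (A *ⱽ v))) i    ≈⟨ *ⱽ-cong {M = A₀} (λ _ _ → refl) (*ᴹ-*ⱽ B A v) i ⟨
      (A₀ *ⱽ ((B *ᴹ A) *ⱽ v)) i    ∎
    right′ : (A *ᴹ (N *ᴹ B)) ≈ᴹ (d ·ᴹ 1ᴹ)
    right′ i j = begin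
      (A *ⱽ (N *ⱽ b)) i                   ≈⟨ A≈ (N *ⱽ b) i ⟩
      (A₀ *ⱽ ((B *ᴹ A) *ⱽ (N *ⱽ b))) i    ≈⟨ *ⱽ-cong {M = A₀} (λ _ _ → refl) step i ⟩
      (A₀ *ⱽ (λ k → d * b k)) i           ≈⟨ *ⱽ-scale d A₀ b i ⟩
      d * (A₀ *ᴹ B) i j                   ≈⟨ *-congˡ (A₀B≈1 i j) ⟩
      d * 1ᴹ i j                          ∎
      where
      b : Vector Carrier _
      b k = B k j
      step : ∀ k → ((B *ᴹ A) *ⱽ (N *ⱽ b)) k ≈ d * b k
      step k = begin
        ((B *ᴹ A) *ⱽ (N *ⱽ b)) k    ≈⟨ *ᴹ-*ⱽ (B *ᴹ A) N b k ⟨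
        (((B *ᴹ A) *ᴹ N) *ⱽ b) k    ≈⟨ *ⱽ-cong {N = d ·ᴹ 1ᴹ} right (λ _ → refl) k ⟩
        ((d ·ᴹ 1ᴹ) *ⱽ b) k          ≈⟨ ·ᴹ-*ⱽ d 1ᴹ b k ⟩
        d * (1ᴹ *ⱽ b) k             ≈⟨ *-congˡ (1ᴹ-*ⱽ b k) ⟩
        d * b k                     ∎

-- Fraction-free elimination relative to a ring homomorphism.

module Elimination {a ℓ b ℓ′} (R : CommutativeRing a ℓ) (S : CommutativeRing b ℓ′)
  {h : CommutativeRing.Carrier R → CommutativeRing.Carrier S}
  (isHom : IsRingHomomorphism (CommutativeRing.rawRing R) (CommutativeRing.rawRing S) h) where
  open import Data.List.Base using (List; []; _∷_; allFin)
  open CommutativeRing R hiding (zero)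
  open MatrixProperties R
  open IsRingHomomorphism isHom
  open Algebra.Properties.Semiring.Sum semiring
  open Algebra.Properties.Ring ring using (-‿distribˡ-*; x[y-z]≈xy-xz)
  open RingLemmas R
  open Relation.Binary.Reasoning.Setoid setoid
  private
    module S where
      open CommutativeRing S public
      open MatrixProperties S public
      open Algebra.Properties.Semiring.Sum (CommutativeRing.semiring S) public
      open RingLemmas S public
      open Relation.Binary.Reasoning.Setoid (CommutativeRing.setoid S) public

  hᴹ : ∀ {n} → Matrix n → S.Matrix n
  hᴹ M i j = h (M i j)

  sum-homo : ∀ {n} (v : Vector Carrier n) → h (sum v) S.≈ S.sum (λ i → h (v i))
  sum-homo {zero}  v = 0#-homo
  sum-homo {suc n} v = S.trans (+-homo _ _) (S.+-congˡ (sum-homo (λ i → v (suc i))))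

  *ᴹ-homo : ∀ {n} (M N : Matrix n) → hᴹ (M *ᴹ N) S.≈ᴹ (hᴹ M S.*ᴹ hᴹ N)
  *ᴹ-homo M N i j = S.trans (sum-homo (λ k → M i k * N k j)) (S.sum-cong-≋ λ k → *-homo (M i k) (N k j))

  1ᴹ-homo : ∀ {n} → hᴹ (1ᴹ {n}) S.≈ᴹ S.1ᴹ
  1ᴹ-homo i j with does (i Fin.≟ j)
  ... | true  = 1#-homo
  ... | false = 0#-homo

  *ᴹ-homo-1ᴹ : ∀ {n} {M N : Matrix n} → (M *ᴹ N) ≈ᴹ 1ᴹ → (hᴹ M S.*ᴹ hᴹ N) S.≈ᴹ S.1ᴹ
  *ᴹ-homo-1ᴹ {M = M} {N} MN≈1 i j =
    S.trans (S.sym (*ᴹ-homo M N i j)) (S.trans (⟦⟧-cong (MN≈1 i j)) (1ᴹ-homo i j))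

  scaledInverse-homo : ∀ {n} {M N : Matrix n} {d} → IsScaledInverse M d N → S.IsScaledInverse (hᴹ M) (h d) (hᴹ N)
  scaledInverse-homo {M = M} {N} {d} (left , right) =
    (λ i j → S.trans (S.sym (*ᴹ-homo N M i j)) (S.trans (⟦⟧-cong (left i j)) (scaled i j))) ,
    (λ i j → S.trans (S.sym (*ᴹ-homo M N i j)) (S.trans (⟦⟧-cong (right i j)) (scaled i j)))
    where
    scaled : ∀ i j → h (d * 1ᴹ i j) S.≈ h d S.* S.1ᴹ i j
    scaled i j = S.trans (*-homo _ _) (S.*-congˡ (1ᴹ-homo i j))

  -‿homo₂ : ∀ x y → h (x - y) S.≈ h x S.- h y
  -‿homo₂ x y = S.trans (+-homo x (- y)) (S.+-congˡ (-‿homo y))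

  -- In the application `h` is the value at `(0,r₀)`. This property replaces the choice of pivots:
  -- it is closed under products, and it gives every diagonal entry the value 1 under `h`.
  LiftsIdentity : ∀ {n} → Matrix n → Set ℓ′
  LiftsIdentity M = hᴹ M S.≈ᴹ S.1ᴹ

  liftsIdentity-*ᴹ : ∀ {n} {M N : Matrix n} → LiftsIdentity M → LiftsIdentity N → LiftsIdentity (M *ᴹ N)
  liftsIdentity-*ᴹ {M = M} {N} M≈1 N≈1 i j = S.trans (*ᴹ-homo M N i j)
    (S.trans (S.*ⱽ-cong {N = S.1ᴹ} M≈1 (λ k → N≈1 k j) i) (S.1ᴹ-*ⱽ (λ k → S.1ᴹ k j) i))

  -- The invariant of the elimination: the columns in `ps` have been cleared. The other columns are
  -- controlled only through `h`, which is enough to find the next pivot.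
  record Reduction {n} (M : Matrix n) (ps : List (Fin n)) : Set (a ⊔ ℓ ⊔ ℓ′) where
    field
      N       : Matrix n
      d       : Carrier
      N-lifts : LiftsIdentity N
      d-lifts : h d S.≈ S.1#
      reduced : ∀ {j} → j ∈ ps → ∀ i → (N *ᴹ M) i j ≈ d * 1ᴹ i j

  -- Fraction-free Gauss–Jordan: clearing column p replaces row i by
  -- a · (row i) − (Gᵢₚ − d δᵢₚ) · (row p) with a = Gₚₚ the pivot, which also
  -- multiplies row p by d. Pivots lift 1, so no search for a pivot is needed.
  reduce : ∀ {n} {M : Matrix n} → LiftsIdentity M → ∀ ps → Reduction M ps
  reduce M≈1 [] = record
    { N = 1ᴹ ; d = 1# ; N-lifts = 1ᴹ-homo ; d-lifts = 1#-homo ; reduced = λ () }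
  reduce {n} {M} M≈1 (p ∷ ps) = record
    { N = N′
    ; d = pivot * d
    ; N-lifts = N′-lifts
    ; d-lifts = S.trans (*-homo _ _) (S.trans (S.*-cong pivot-lifts d-lifts) (S.*-identityˡ _))
    ; reduced = reduced′
    }
    where
    open Reduction (reduce M≈1 ps)
    G : Matrix n
    G = N *ᴹ M
    G-lifts : LiftsIdentity G
    G-lifts = liftsIdentity-*ᴹ N-lifts M≈1
    pivot : Carrier
    pivot = G p p
    pivot-lifts : h pivot S.≈ S.1#
    pivot-lifts = S.trans (G-lifts p p) (S.reflexive (S.1ᴹ-diagonal p))
    β : Fin n → Carrier
    β i = G i p - d * 1ᴹ i p
    -- Under `h` both `G` and `d` times the identity become the identity. The multipliers thus
    -- vanish there, and the row operation preserves the invariant `N-lifts`.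
    β-lifts : ∀ i → h (β i) S.≈ S.0#
    β-lifts i = S.begin
      h (G i p - d * 1ᴹ i p)          S.≈⟨ -‿homo₂ _ _ ⟩
      h (G i p) S.- h (d * 1ᴹ i p)    S.≈⟨ S.+-cong (G-lifts i p) (S.-‿cong (S.trans (*-homo _ _) (S.*-cong d-lifts (1ᴹ-homo i p)))) ⟩
      S.1ᴹ i p S.- S.1# S.* S.1ᴹ i p  S.≈⟨ S.+-congˡ (S.-‿cong (S.*-identityˡ _)) ⟩
      S.1ᴹ i p S.- S.1ᴹ i p           S.≈⟨ S.-‿inverseʳ _ ⟩
      S.0#                            S.∎
    N′ : Matrix n
    N′ i l = pivot * N i l - β i * N p l
    N′-lifts : LiftsIdentity N′
    N′-lifts i l = S.begin
      h (pivot * N i l - β i * N p l)                  S.≈⟨ -‿homo₂ _ _ ⟩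
      h (pivot * N i l) S.- h (β i * N p l)            S.≈⟨ S.+-cong (*-homo _ _) (S.-‿cong (*-homo _ _)) ⟩
      h pivot S.* h (N i l) S.- h (β i) S.* h (N p l)  S.≈⟨ S.+-cong (S.*-cong pivot-lifts (N-lifts i l)) (S.-‿cong (S.*-congʳ (β-lifts i))) ⟩
      S.1# S.* S.1ᴹ i l S.- S.0# S.* h (N p l)         S.≈⟨ S.+-cong (S.*-identityˡ _) (S.-‿cong (S.zeroˡ _)) ⟩
      S.1ᴹ i l S.- S.0#                                S.≈⟨ S.x-0#≈x _ ⟩
      S.1ᴹ i l                                         S.∎
    row : ∀ i j → (N′ *ᴹ M) i j ≈ pivot * G i j - β i * G p j
    row i j = begin
      sum (λ k → (pivot * N i k - β i * N p k) * M k j)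
        ≈⟨ sum-cong-≋ term ⟩
      sum (λ k → pivot * (N i k * M k j) + - β i * (N p k * M k j))
        ≈⟨ ∑-distrib-+ (λ k → pivot * (N i k * M k j)) (λ k → - β i * (N p k * M k j)) ⟩
      sum (λ k → pivot * (N i k * M k j)) + sum (λ k → - β i * (N p k * M k j))
        ≈⟨ +-cong (*-distribˡ-sum pivot (λ k → N i k * M k j)) (*-distribˡ-sum (- β i) (λ k → N p k * M k j)) ⟨
      pivot * G i j + - β i * G p j
        ≈⟨ +-congˡ (-‿distribˡ-* _ _) ⟨
      pivot * G i j - β i * G p j ∎
      where
      term : ∀ k → (pivot * N i k - β i * N p k) * M k j ≈ pivot * (N i k * M k j) + - β i * (N p k * M k j)
      term k = begin
        (pivot * N i k - β i * N p k) * M k j                  ≈⟨ distribʳ _ _ _ ⟩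
        pivot * N i k * M k j + - (β i * N p k) * M k j        ≈⟨ +-cong (*-assoc _ _ _) (*-congʳ (-‿distribˡ-* _ _)) ⟩
        pivot * (N i k * M k j) + - β i * N p k * M k j        ≈⟨ +-congˡ (*-assoc _ _ _) ⟩
        pivot * (N i k * M k j) + - β i * (N p k * M k j)      ∎
    pivotColumn : ∀ i → (N′ *ᴹ M) i p ≈ pivot * d * 1ᴹ i p
    pivotColumn i = begin
      (N′ *ᴹ M) i p                                      ≈⟨ row i p ⟩
      pivot * G i p - β i * pivot                        ≈⟨ +-congˡ (-‿cong (*-comm _ _)) ⟩
      pivot * G i p - pivot * β i                        ≈⟨ x[y-z]≈xy-xz _ _ _ ⟨
      pivot * (G i p - (G i p - d * 1ᴹ i p))             ≈⟨ *-congˡ (x-[x-y]≈y _ _) ⟩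
      pivot * (d * 1ᴹ i p)                               ≈⟨ *-assoc _ _ _ ⟨
      pivot * d * 1ᴹ i p                                 ∎
    reduced′ : ∀ {j} → j ∈ p ∷ ps → ∀ i → (N′ *ᴹ M) i j ≈ pivot * d * 1ᴹ i j
    reduced′ (here ≡.refl) i = pivotColumn i
    reduced′ {j} (there j∈ps) i with p Fin.≟ j
    -- The list may contain `p` again; the new pivot step then settles this column anew.
    ... | yes ≡.refl = pivotColumn i
    -- Column `j` was cleared before, so row `p` has a zero in it, and subtracting a multiple of row
    -- `p` leaves it cleared.
    ... | no p≢j     = begin
      (N′ *ᴹ M) i j                        ≈⟨ row i j ⟩
      pivot * G i j - β i * G p j          ≈⟨ +-cong (*-congˡ (reduced j∈ps i)) (-‿cong (*-congˡ (reduced j∈ps p))) ⟩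
      pivot * (d * 1ᴹ i j) - β i * (d * 1ᴹ p j)
        ≈⟨ +-congˡ (-‿cong (*-congˡ (*-congˡ (reflexive (1ᴹ-offDiagonal p≢j))))) ⟩
      pivot * (d * 1ᴹ i j) - β i * (d * 0#)  ≈⟨ +-congˡ (-‿cong (trans (*-congˡ (zeroʳ d)) (zeroʳ _))) ⟩
      pivot * (d * 1ᴹ i j) - 0#              ≈⟨ x-0#≈x _ ⟩
      pivot * (d * 1ᴹ i j)                   ≈⟨ *-assoc _ _ _ ⟨
      pivot * d * 1ᴹ i j                     ∎

  -- Row operations give a scaled inverse on the left only. The one on the right comes from
  -- eliminating in the transpose; its scalar may differ, which is why the two are then combined.
  scaledInverse : ∀ {n} {M : Matrix n} → LiftsIdentity M →
    Σ[ N ∈ Matrix n ] Σ[ d ∈ Carrier ] IsScaledInverse M d N × h d S.≈ S.1#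
  scaledInverse {n} {M} M≈1 = Rˡ.d ·ᴹ (Rʳ.N ᵀ) , Rˡ.d * Rʳ.d , scaledInverse-combine {N₁ = Rˡ.N} {N₂ = Rʳ.N ᵀ} left right ,
    S.trans (*-homo _ _) (S.trans (S.*-cong Rˡ.d-lifts Rʳ.d-lifts) (S.*-identityˡ _))
    where
    module Rˡ = Reduction (reduce M≈1 (allFin n))
    module Rʳ = Reduction (reduce {M = M ᵀ} (λ i j → S.trans (M≈1 j i) (S.reflexive (S.1ᴹ-sym j i))) (allFin n))
    left : (Rˡ.N *ᴹ M) ≈ᴹ (Rˡ.d ·ᴹ 1ᴹ)
    left i j = Rˡ.reduced (∈-allFin j) i
    right : (M *ᴹ (Rʳ.N ᵀ)) ≈ᴹ (Rʳ.d ·ᴹ 1ᴹ)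
    right i j = begin
      (M *ᴹ (Rʳ.N ᵀ)) i j  ≈⟨ ᵀ-*ᴹ Rʳ.N (M ᵀ) i j ⟨
      (Rʳ.N *ᴹ (M ᵀ)) j i  ≈⟨ Rʳ.reduced (∈-allFin i) j ⟩
      Rʳ.d * 1ᴹ j i        ≡⟨ ≡.cong (Rʳ.d *_) (1ᴹ-sym j i) ⟩
      Rʳ.d * 1ᴹ i j        ∎

  -- Passing to `B A` makes the value under `h` the identity. `A₀` is there to undo the factor `B`
  -- over `R` itself, not only after applying `h`; in the application `A₀` and `B` are matrices of
  -- constant polynomials.
  invertible⇒scaledInverse : ∀ {n} {A A₀ B : Matrix n} →
    (A₀ *ᴹ B) ≈ᴹ 1ᴹ → (hᴹ B S.*ᴹ hᴹ A) S.≈ᴹ S.1ᴹ →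
    Σ[ N ∈ Matrix n ] Σ[ d ∈ Carrier ] IsScaledInverse A d N × h d S.≈ S.1#
  invertible⇒scaledInverse {A = A} {A₀} {B} A₀B≈1 hBhA≈1
    with scaledInverse {M = B *ᴹ A} (λ i j → S.trans (*ᴹ-homo B A i j) (hBhA≈1 i j))
  ... | N , d , inv , hd≈1 = N *ᴹ B , d , scaledInverse-*ᴹ {A = A} {A₀} {B} {N} A₀B≈1 inv , hd≈1

∀-↑ : ∀ {m k q} {Q : Fin (m ℕ.+ k) → Set q} → (∀ i → Q (i ↑ˡ k)) → (∀ i → Q (m ↑ʳ i)) → ∀ i → Q i
∀-↑ {m} {k} {Q = Q} l r i = ≡.subst Q (Fin.join-splitAt m k i) (cases (splitAt m i))
  where
  cases : ∀ s → Q (join m k s)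
  cases (inj₁ i) = l i
  cases (inj₂ i) = r i

module StreamTheory {c ℓ₁ ℓ₂} (F : HeytingField c ℓ₁ ℓ₂) where
  open import Data.List.Base using (List; []; _∷_; [_]; concat; foldr; map; replicate; tabulate) renaming (_++_ to _++ˡ_)
  open import Data.List.Relation.Unary.All as All using (All; []; _∷_)
  open StreamCalculus F hiding (_≈_; 0#)

  fieldRing : CommutativeRing c ℓ₁
  fieldRing = HeytingCommutativeRing.commutativeRing (HeytingField.heytingCommutativeRing F)

  -- Relations preserved by polynomial evaluation.

  module EvaluationRelation {a b ℓ ℓ′} (R : RawRing a ℓ) (ιᴿ : Carrier → RawRing.Carrier R)
    (S : RawRing b ℓ′) (ιˢ : Carrier → RawRing.Carrier S) where
    private
      module R where
        open RawRing R public
        open Algebra.Definitions.RawSemiring (RawRing.rawSemiring R) public using (product; _^_)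
        open Evaluation R ιᴿ public
      module S where
        open RawRing S public
        open Algebra.Definitions.RawSemiring (RawRing.rawSemiring S) public using (product; _^_)
        open Evaluation S ιˢ public

    module _ {r} {_~_ : R.Carrier → S.Carrier → Set r}
      (0~ : R.0# ~ S.0#) (1~ : R.1# ~ S.1#)
      (+~ : ∀ {x y u v} → x ~ u → y ~ v → (x R.+ y) ~ (u S.+ v))
      (*~ : ∀ {x y u v} → x ~ u → y ~ v → (x R.* y) ~ (u S.* v))
      (ι~ : ∀ k → ιᴿ k ~ ιˢ k) where

      ^-related : ∀ {x u} → x ~ u → ∀ e → (x R.^ e) ~ (u S.^ e)
      ^-related x~u zero    = 1~
      ^-related x~u (suc e) = *~ x~u (^-related x~u e)

      product-related : ∀ {m} {v : Vector R.Carrier m} {w : Vector S.Carrier m} →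
        (∀ i → v i ~ w i) → R.product v ~ S.product w
      product-related {zero}  v~w = 1~
      product-related {suc m} v~w = *~ (v~w zero) (product-related (v~w ∘ suc))

      -- Parametricity of evaluation, proved once for an arbitrary relation. Equality yields
      -- congruence, the graphs of `η`, `ι` and of evaluation yield commutation with these maps and
      -- the substitution lemma, and agreement of streams up to an index yields causality.
      ⟦⟧-related : ∀ {m} (p : Poly m) {ρ : Vector R.Carrier m} {ρ′ : Vector S.Carrier m} →
        (∀ i → ρ i ~ ρ′ i) → R.⟦ p ⟧ ρ ~ S.⟦ p ⟧ ρ′
      ⟦⟧-related []            ρ~ρ′ = 0~
      ⟦⟧-related ((k , μ) ∷ p) ρ~ρ′ =
        +~ (*~ (ι~ k) (product-related λ i → ^-related (ρ~ρ′ i) (Vec.lookup μ i))) (⟦⟧-related p ρ~ρ′)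

  -ᵖ_ : ∀ {m} → Poly m → Poly m
  -ᵖ p = CommutativeRing.-_ fieldRing (CommutativeRing.1# fieldRing) ·ᵖ p

  constᵖ : ∀ {m} → Carrier → Poly m
  constᵖ k = [ k , 1ᵐ ]

  -- Evaluation as a ring homomorphism, and coefficients in the last indeterminates.

  module PolynomialEvaluation {a ℓ} (S : CommutativeRing a ℓ) {ι : Carrier → CommutativeRing.Carrier S}
    (ι-isHom : IsRingHomomorphism (fieldRawRing F) (CommutativeRing.rawRing S) ι) where
    private
      module K = CommutativeRing fieldRing
      module ι = IsRingHomomorphism ι-isHom
    open CommutativeRing S hiding (zero) renaming (Carrier to A)
    open Evaluation rawRing ι
    open Algebra.Definitions.RawSemiring (RawRing.rawSemiring rawRing) using (sum; product; _^_)
    open Algebra.Properties.Semiring.Sum semiring using (sum-cong-≋; sum-replicate-zero; ∑-distrib-+; *-distribˡ-sum)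
    open Algebra.Properties.CommutativeMonoid.Sum *-commutativeMonoid using () renaming (sum-cong-≋ to product-cong; sum-cong-≗ to product-cong-≗; ∑-distrib-+ to product-distrib-*)
    open Algebra.Properties.Monoid.Mult *-monoid using () renaming (×-homo-+ to ^-homo-+)
    open Algebra.Properties.CommutativeSemigroup *-commutativeSemigroup using (interchange; x∙yz≈y∙xz)
    open Algebra.Properties.Ring ring using (-1*x≈-x)
    open MatrixProperties S using (1ᴹ; 1ᴹ-*ⱽ)
    open Relation.Binary.Reasoning.Setoid setoid

    monomial : ∀ {m} → Vector A m → Monomial m → A
    monomial ρ μ = product λ i → ρ i ^ Vec.lookup μ i

    monomial-1ᵐ : ∀ {m} (ρ : Vector A m) → monomial ρ 1ᵐ ≈ 1#
    monomial-1ᵐ {zero}  ρ = refl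
    monomial-1ᵐ {suc m} ρ = trans (*-identityˡ _) (monomial-1ᵐ (ρ ∘ suc))

    monomial-varᵐ : ∀ {m} (ρ : Vector A m) i → monomial ρ (varᵐ i) ≈ ρ i
    monomial-varᵐ ρ zero    = trans (*-cong (*-identityʳ _) (monomial-1ᵐ (ρ ∘ suc))) (*-identityʳ _)
    monomial-varᵐ ρ (suc i) = trans (*-identityˡ _) (monomial-varᵐ (ρ ∘ suc) i)

    monomial-* : ∀ {m} (ρ : Vector A m) μ ν → monomial ρ (Vec.zipWith ℕ._+_ μ ν) ≈ monomial ρ μ * monomial ρ ν
    monomial-* ρ μ ν = begin
      product (λ i → ρ i ^ Vec.lookup (Vec.zipWith ℕ._+_ μ ν) i)
        ≡⟨ product-cong-≗ (λ i → ≡.cong (ρ i ^_) (Vec.lookup-zipWith ℕ._+_ i μ ν)) ⟩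
      product (λ i → ρ i ^ (Vec.lookup μ i ℕ.+ Vec.lookup ν i))
        ≈⟨ product-cong (λ i → ^-homo-+ (ρ i) (Vec.lookup μ i) (Vec.lookup ν i)) ⟩
      product (λ i → ρ i ^ Vec.lookup μ i * ρ i ^ Vec.lookup ν i)
        ≈⟨ product-distrib-* (λ i → ρ i ^ Vec.lookup μ i) (λ i → ρ i ^ Vec.lookup ν i) ⟩
      monomial ρ μ * monomial ρ ν ∎

    ⊕-suc : ∀ {b} {B : Set b} {m k} (ρ : Vector B (suc m)) (δ : Vector B k) i → (ρ ⊕ δ) (suc i) ≡ ((ρ ∘ suc) ⊕ δ) i
    ⊕-suc {m = m} ρ δ i with splitAt m i
    ... | inj₁ _ = ≡.refl
    ... | inj₂ _ = ≡.refl

    monomial-⊕ : ∀ m {k} (ρ : Vector A m) (δ : Vector A k) μ →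
      monomial (ρ ⊕ δ) μ ≈ monomial ρ (Vec.take m μ) * monomial δ (Vec.drop m μ)
    monomial-⊕ zero    ρ δ μ           = sym (*-identityˡ _)
    monomial-⊕ (suc m) ρ δ (e Vec.∷ μ) = begin
      ρ zero ^ e * monomial ((ρ ⊕ δ) ∘ suc) μ
        ≡⟨ ≡.cong (ρ zero ^ e *_) (product-cong-≗ λ i → ≡.cong (_^ Vec.lookup μ i) (⊕-suc ρ δ i)) ⟩
      ρ zero ^ e * monomial ((ρ ∘ suc) ⊕ δ) μ
        ≈⟨ *-congˡ (monomial-⊕ m (ρ ∘ suc) δ μ) ⟩
      ρ zero ^ e * (monomial (ρ ∘ suc) (Vec.take m μ) * monomial δ (Vec.drop m μ))
        ≈⟨ *-assoc _ _ _ ⟨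
      ρ zero ^ e * monomial (ρ ∘ suc) (Vec.take m μ) * monomial δ (Vec.drop m μ) ∎

    ⟦⟧-+ : ∀ {m} (p q : Poly m) ρ → ⟦ p +ᵖ q ⟧ ρ ≈ ⟦ p ⟧ ρ + ⟦ q ⟧ ρ
    ⟦⟧-+ []      q ρ = sym (+-identityˡ _)
    ⟦⟧-+ (t ∷ p) q ρ = trans (+-congˡ (⟦⟧-+ p q ρ)) (sym (+-assoc _ _ _))

    ⟦⟧-· : ∀ {m} k (p : Poly m) ρ → ⟦ k ·ᵖ p ⟧ ρ ≈ ι k * ⟦ p ⟧ ρ
    ⟦⟧-· k []            ρ = sym (zeroʳ _)
    ⟦⟧-· k ((l , μ) ∷ p) ρ = begin
      ι (k K.* l) * monomial ρ μ + ⟦ k ·ᵖ p ⟧ ρ     ≈⟨ +-cong (trans (*-congʳ (ι.*-homo k l)) (*-assoc _ _ _)) (⟦⟧-· k p ρ) ⟩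
      ι k * (ι l * monomial ρ μ) + ι k * ⟦ p ⟧ ρ    ≈⟨ distribˡ _ _ _ ⟨
      ι k * (ι l * monomial ρ μ + ⟦ p ⟧ ρ)          ∎

    ⟦⟧-term* : ∀ {m} k (μ : Monomial m) q ρ →
      ⟦ map (λ (l , ν) → k K.* l , Vec.zipWith ℕ._+_ μ ν) q ⟧ ρ ≈ ι k * monomial ρ μ * ⟦ q ⟧ ρ
    ⟦⟧-term* k μ []            ρ = sym (zeroʳ _)
    ⟦⟧-term* k μ ((l , ν) ∷ q) ρ = begin
      ι (k K.* l) * monomial ρ (Vec.zipWith ℕ._+_ μ ν) + _
        ≈⟨ +-cong (*-cong (ι.*-homo k l) (monomial-* ρ μ ν)) (⟦⟧-term* k μ q ρ) ⟩
      ι k * ι l * (monomial ρ μ * monomial ρ ν) + ι k * monomial ρ μ * ⟦ q ⟧ ρ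
        ≈⟨ +-congʳ (interchange _ _ _ _) ⟩
      ι k * monomial ρ μ * (ι l * monomial ρ ν) + ι k * monomial ρ μ * ⟦ q ⟧ ρ
        ≈⟨ distribˡ _ _ _ ⟨
      ι k * monomial ρ μ * (ι l * monomial ρ ν + ⟦ q ⟧ ρ) ∎

    ⟦⟧-* : ∀ {m} (p q : Poly m) ρ → ⟦ p *ᵖ q ⟧ ρ ≈ ⟦ p ⟧ ρ * ⟦ q ⟧ ρ
    ⟦⟧-* []            q ρ = sym (zeroˡ _)
    ⟦⟧-* ((k , μ) ∷ p) q ρ = begin
      ⟦ ((k , μ) ∷ p) *ᵖ q ⟧ ρ                          ≈⟨ ⟦⟧-+ (map _ q) (p *ᵖ q) ρ ⟩
      _ + ⟦ p *ᵖ q ⟧ ρ                                  ≈⟨ +-cong (⟦⟧-term* k μ q ρ) (⟦⟧-* p q ρ) ⟩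
      ι k * monomial ρ μ * ⟦ q ⟧ ρ + ⟦ p ⟧ ρ * ⟦ q ⟧ ρ  ≈⟨ distribʳ _ _ _ ⟨
      (ι k * monomial ρ μ + ⟦ p ⟧ ρ) * ⟦ q ⟧ ρ          ∎

    ⟦⟧-neg : ∀ {m} (p : Poly m) ρ → ⟦ -ᵖ p ⟧ ρ ≈ - ⟦ p ⟧ ρ
    ⟦⟧-neg p ρ = begin
      ⟦ -ᵖ p ⟧ ρ              ≈⟨ ⟦⟧-· (K.- K.1#) p ρ ⟩
      ι (K.- K.1#) * ⟦ p ⟧ ρ  ≈⟨ *-congʳ (trans (ι.-‿homo K.1#) (-‿cong ι.1#-homo)) ⟩
      - 1# * ⟦ p ⟧ ρ          ≈⟨ -1*x≈-x _ ⟩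
      - ⟦ p ⟧ ρ               ∎

    ⟦⟧-const : ∀ {m} k (ρ : Vector A m) → ⟦ constᵖ k ⟧ ρ ≈ ι k
    ⟦⟧-const k ρ = trans (+-identityʳ _) (trans (*-congˡ (monomial-1ᵐ ρ)) (*-identityʳ _))

    ⟦⟧-1 : ∀ {m} (ρ : Vector A m) → ⟦ 1ᵖ ⟧ ρ ≈ 1#
    ⟦⟧-1 ρ = trans (⟦⟧-const K.1# ρ) ι.1#-homo

    ⟦⟧-var : ∀ {m} (ρ : Vector A m) i → ⟦ var i ⟧ ρ ≈ ρ i
    ⟦⟧-var ρ i = begin
      ι K.1# * monomial ρ (varᵐ i) + 0#  ≈⟨ +-identityʳ _ ⟩
      ι K.1# * monomial ρ (varᵐ i)       ≈⟨ *-cong ι.1#-homo (monomial-varᵐ ρ i) ⟩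
      1# * ρ i                           ≈⟨ *-identityˡ _ ⟩
      ρ i                                ∎

    -- Poly m modulo equality of all values in S, which is all that the theorem
    -- can observe of a polynomial.
    polyRawRing : ℕ → RawRing c (a ⊔ ℓ)
    polyRawRing m = record
      { Carrier = Poly m
      ; _≈_     = λ p q → ∀ ρ → ⟦ p ⟧ ρ ≈ ⟦ q ⟧ ρ
      ; _+_     = _+ᵖ_
      ; _*_     = _*ᵖ_
      ; -_      = -ᵖ_
      ; 0#      = 0ᵖ
      ; 1#      = 1ᵖ
      }

    ⟦⟧-isRingHomomorphism : ∀ {m} (ρ : Vector A m) → IsRingHomomorphism (polyRawRing m) rawRing (λ p → ⟦ p ⟧ ρ)
    ⟦⟧-isRingHomomorphism ρ = record
      { isSemiringHomomorphism = record
        { isNearSemiringHomomorphism = record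
          { +-isMonoidHomomorphism = record
            { isMagmaHomomorphism = record
              { isRelHomomorphism = record { cong = λ p≈q → p≈q ρ }
              ; homo              = λ p q → ⟦⟧-+ p q ρ
              }
            ; ε-homo = refl
            }
          ; *-homo = λ p q → ⟦⟧-* p q ρ
          }
        ; 1#-homo = ⟦⟧-1 ρ
        }
      ; -‿homo = λ p → ⟦⟧-neg p ρ
      }

    -- As lists of terms, polynomials do not satisfy the ring laws: already the order of the terms
    -- in a sum matters. Evaluation into the functions `Vector A m → A` is injective for the
    -- equality chosen above, so the laws are pulled back from there.
    polyRing : ℕ → CommutativeRing c (a ⊔ ℓ)
    polyRing m = record { isCommutativeRing = Algebra.Morphism.RingMonomorphism.isCommutativeRing embedding
                            (CommutativeRing.isCommutativeRing functions) }
      where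
      functions : CommutativeRing (a ⊔ a) (a ⊔ ℓ)
      functions = Algebra.Construct.Pointwise.commutativeRing (Vector A m) S
      embedding : IsRingMonomorphism (polyRawRing m) (CommutativeRing.rawRing functions) ⟦_⟧
      embedding = record
        { isRingHomomorphism = record
          { isSemiringHomomorphism = record
            { isNearSemiringHomomorphism = record
              { +-isMonoidHomomorphism = record
                { isMagmaHomomorphism = record
                  { isRelHomomorphism = record { cong = λ p≈q → p≈q }
                  ; homo              = ⟦⟧-+
                  }
                ; ε-homo = λ _ → refl
                }
              ; *-homo = ⟦⟧-*
              }
            ; 1#-homo = ⟦⟧-1
            }
          ; -‿homo = ⟦⟧-neg
          }
        ; injective = λ p≈q → p≈q
        }

    coeff-∷ : ∀ {m k} (ν : Monomial k) l (μ : Monomial (m ℕ.+ k)) p (ρ : Vector A m) →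
      ⟦ coeff ν ((l , μ) ∷ p) ⟧ ρ ≈
      (if does (Vec.≡-dec ℕ._≟_ (Vec.drop m μ) ν) then ι l * monomial ρ (Vec.take m μ) else 0#) + ⟦ coeff ν p ⟧ ρ
    coeff-∷ {m} ν l μ p ρ with does (Vec.≡-dec ℕ._≟_ (Vec.drop m μ) ν)
    ... | true  = refl
    ... | false = sym (+-identityˡ _)

    coeff-∷-≡ : ∀ {m k} {ν : Monomial k} l {μ : Monomial (m ℕ.+ k)} p (ρ : Vector A m) → Vec.drop m μ ≡ ν →
      ⟦ coeff ν ((l , μ) ∷ p) ⟧ ρ ≈ ι l * monomial ρ (Vec.take m μ) + ⟦ coeff ν p ⟧ ρ
    coeff-∷-≡ {m} {ν = ν} l {μ} p ρ eq = trans (coeff-∷ ν l μ p ρ)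
      (+-congʳ (reflexive (≡.cong (λ b → if b then _ else 0#) (dec-true (Vec.≡-dec ℕ._≟_ (Vec.drop m μ) ν) eq))))

    coeff-∷-≢ : ∀ {m k} {ν : Monomial k} l {μ : Monomial (m ℕ.+ k)} p (ρ : Vector A m) → Vec.drop m μ ≢ ν →
      ⟦ coeff ν ((l , μ) ∷ p) ⟧ ρ ≈ ⟦ coeff ν p ⟧ ρ
    coeff-∷-≢ {m} {ν = ν} l {μ} p ρ neq = trans (coeff-∷ ν l μ p ρ)
      (trans (+-congʳ (reflexive (≡.cong (λ b → if b then _ else 0#) (dec-false (Vec.≡-dec ℕ._≟_ (Vec.drop m μ) ν) neq))))
             (+-identityˡ _))

    varᵐ≢1ᵐ : ∀ {m} (i : Fin m) → varᵐ i ≢ 1ᵐ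
    varᵐ≢1ᵐ (suc i) eq = varᵐ≢1ᵐ i (Vec.∷-injectiveʳ eq)

    varᵐ-injective : ∀ {m} (i j : Fin m) → varᵐ i ≡ varᵐ j → i ≡ j
    varᵐ-injective zero    zero    eq = ≡.refl
    varᵐ-injective (suc i) (suc j) eq = ≡.cong suc (varᵐ-injective i j (Vec.∷-injectiveʳ eq))

    ⟦⟧-constant : ∀ m {k} {p : Poly (m ℕ.+ k)} → All (λ t → Vec.drop m (proj₂ t) ≡ 1ᵐ) p →
      ∀ (ρ : Vector A m) (δ : Vector A k) → ⟦ p ⟧ (ρ ⊕ δ) ≈ ⟦ coeff {m} {k} 1ᵐ p ⟧ ρ
    ⟦⟧-constant m []                            ρ δ = refl
    ⟦⟧-constant m {k} {(l , μ) ∷ p} (eq ∷ eqs) ρ δ = begin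
      ι l * monomial (ρ ⊕ δ) μ + ⟦ p ⟧ (ρ ⊕ δ)
        ≈⟨ +-cong (*-congˡ (monomial-⊕ m ρ δ μ)) (⟦⟧-constant m eqs ρ δ) ⟩
      ι l * (monomial ρ (Vec.take m μ) * monomial δ (Vec.drop m μ)) + ⟦ coeff {m} {k} 1ᵐ p ⟧ ρ
        ≈⟨ +-congʳ (*-congˡ (trans (*-congˡ (trans (reflexive (≡.cong (monomial δ) eq)) (monomial-1ᵐ δ))) (*-identityʳ _))) ⟩
      ι l * monomial ρ (Vec.take m μ) + ⟦ coeff {m} {k} 1ᵐ p ⟧ ρ
        ≈⟨ coeff-∷-≡ {m} l p ρ eq ⟨
      ⟦ coeff {m} {k} 1ᵐ ((l , μ) ∷ p) ⟧ ρ ∎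

    -- Each term contributes to exactly one coefficient: to that of `1ᵐ`, or to that of a single
    -- `varᵐ i`. Applied to `deriv p`, this is the decomposition `p′ = q₀ + Σ qᵢ yᵢ′` at the level
    -- of values.
    ⟦⟧-affine : ∀ m {k} {p : Poly (m ℕ.+ k)} →
      All (λ t → Vec.drop m (proj₂ t) ≡ 1ᵐ ⊎ (∃[ i ] Vec.drop m (proj₂ t) ≡ varᵐ i)) p →
      ∀ (ρ : Vector A m) (δ : Vector A k) → ⟦ p ⟧ (ρ ⊕ δ) ≈ ⟦ coeff {m} {k} 1ᵐ p ⟧ ρ + sum (λ i → ⟦ coeff {m} (varᵐ i) p ⟧ ρ * δ i)
    ⟦⟧-affine m {k} [] ρ δ = sym (trans (+-identityˡ _) (trans (sum-cong-≋ {k} (λ i → zeroˡ (δ i))) (sum-replicate-zero k)))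
    ⟦⟧-affine m {k} {(l , μ) ∷ p} (inj₁ eq ∷ eqs) ρ δ = begin
      ι l * monomial (ρ ⊕ δ) μ + ⟦ p ⟧ (ρ ⊕ δ)
        ≈⟨ +-cong (*-congˡ (monomial-⊕ m ρ δ μ)) (⟦⟧-affine m eqs ρ δ) ⟩
      ι l * (monomial ρ (Vec.take m μ) * monomial δ (Vec.drop m μ)) + (⟦ coeff {m} {k} 1ᵐ p ⟧ ρ + linear)
        ≈⟨ +-congʳ (*-congˡ (trans (*-congˡ (trans (reflexive (≡.cong (monomial δ) eq)) (monomial-1ᵐ δ))) (*-identityʳ _))) ⟩
      ι l * monomial ρ (Vec.take m μ) + (⟦ coeff {m} {k} 1ᵐ p ⟧ ρ + linear)
        ≈⟨ +-assoc _ _ _ ⟨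
      ι l * monomial ρ (Vec.take m μ) + ⟦ coeff {m} {k} 1ᵐ p ⟧ ρ + linear
        ≈⟨ +-cong (coeff-∷-≡ {m} l p ρ eq) (sum-cong-≋ λ i → *-congʳ (coeff-∷-≢ {m} l p ρ λ eq′ → varᵐ≢1ᵐ i (≡.trans (≡.sym eq′) eq))) ⟨
      ⟦ coeff {m} {k} 1ᵐ ((l , μ) ∷ p) ⟧ ρ + sum (λ i → ⟦ coeff {m} (varᵐ i) ((l , μ) ∷ p) ⟧ ρ * δ i) ∎
      where
      linear : A
      linear = sum (λ i → ⟦ coeff {m} (varᵐ i) p ⟧ ρ * δ i)
    ⟦⟧-affine m {k} {(l , μ) ∷ p} (inj₂ (j , eq) ∷ eqs) ρ δ = begin
      ι l * monomial (ρ ⊕ δ) μ + ⟦ p ⟧ (ρ ⊕ δ)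
        ≈⟨ +-cong (*-congˡ (monomial-⊕ m ρ δ μ)) (⟦⟧-affine m eqs ρ δ) ⟩
      ι l * (monomial ρ (Vec.take m μ) * monomial δ (Vec.drop m μ)) + (⟦ coeff {m} {k} 1ᵐ p ⟧ ρ + linear)
        ≈⟨ +-congʳ (trans (sym (*-assoc _ _ _)) (*-congˡ (trans (reflexive (≡.cong (monomial δ) eq)) (monomial-varᵐ δ j)))) ⟩
      T * δ j + (⟦ coeff {m} {k} 1ᵐ p ⟧ ρ + linear)
        ≈⟨ x+yz _ _ _ ⟩
      ⟦ coeff {m} {k} 1ᵐ p ⟧ ρ + (T * δ j + linear)
        ≈⟨ +-cong (coeff-∷-≢ {m} l p ρ λ eq′ → varᵐ≢1ᵐ j (≡.trans (≡.sym eq) eq′)) Σ-step ⟨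
      ⟦ coeff {m} {k} 1ᵐ ((l , μ) ∷ p) ⟧ ρ + sum (λ i → ⟦ coeff {m} (varᵐ i) ((l , μ) ∷ p) ⟧ ρ * δ i) ∎
      where
      open Algebra.Properties.CommutativeSemigroup +-commutativeSemigroup using () renaming (x∙yz≈y∙xz to x+yz)
      T linear : A
      T = ι l * monomial ρ (Vec.take m μ)
      linear = sum (λ i → ⟦ coeff {m} (varᵐ i) p ⟧ ρ * δ i)
      -- The Kronecker delta `1ᴹ j i` records that only coefficient `j` receives the new term;
      -- summed against `δ`, it is the identity matrix applied to a vector.
      coefficient : ∀ i → ⟦ coeff {m} (varᵐ i) ((l , μ) ∷ p) ⟧ ρ ≈ T * 1ᴹ j i + ⟦ coeff {m} (varᵐ i) p ⟧ ρ
      coefficient i with j Fin.≟ i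
      ... | yes ≡.refl = trans (coeff-∷-≡ {m} l p ρ eq) (+-congʳ (sym (*-identityʳ _)))
      ... | no j≢i     = trans (coeff-∷-≢ {m} l p ρ λ eq′ → j≢i (varᵐ-injective j i (≡.trans (≡.sym eq) eq′)))
                               (sym (trans (+-congʳ (zeroʳ _)) (+-identityˡ _)))
      Σ-step : sum (λ i → ⟦ coeff {m} (varᵐ i) ((l , μ) ∷ p) ⟧ ρ * δ i) ≈ T * δ j + linear
      Σ-step = begin
        sum (λ i → ⟦ coeff {m} (varᵐ i) ((l , μ) ∷ p) ⟧ ρ * δ i)
          ≈⟨ sum-cong-≋ (λ i → trans (*-congʳ (coefficient i)) (trans (distribʳ _ _ _) (+-congʳ (*-assoc _ _ _)))) ⟩
        sum (λ i → T * (1ᴹ j i * δ i) + ⟦ coeff {m} (varᵐ i) p ⟧ ρ * δ i)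
          ≈⟨ ∑-distrib-+ (λ i → T * (1ᴹ j i * δ i)) (λ i → ⟦ coeff {m} (varᵐ i) p ⟧ ρ * δ i) ⟩
        sum (λ i → T * (1ᴹ j i * δ i)) + linear
          ≈⟨ +-congʳ (*-distribˡ-sum T (λ i → 1ᴹ j i * δ i)) ⟨
        T * sum (λ i → 1ᴹ j i * δ i) + linear
          ≈⟨ +-congʳ (*-congˡ (1ᴹ-*ⱽ δ j)) ⟩
        T * δ j + linear ∎

  -- What the proof uses of the ring of streams: η is σ ↦ σ(0), as a constant
  -- stream, and D is σ ↦ σ′.
  record StreamAlgebra a ℓ : Set (c ⊔ ℓ₁ ⊔ Level.suc (a ⊔ ℓ)) where
    field
      ring : CommutativeRing a ℓ
    open CommutativeRing ring using (_≈_; _+_; _*_; 0#; 1#; rawRing) renaming (Carrier to A)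
    field
      ι                    : Carrier → A
      ι-isRingHomomorphism : IsRingHomomorphism (fieldRawRing F) rawRing ι
      η                    : A → A
      η-isRingHomomorphism : IsRingHomomorphism rawRing rawRing η
      η-ι                  : ∀ k → η (ι k) ≈ ι k
      D                    : A → A
      D-cong               : ∀ {x y} → x ≈ y → D x ≈ D y
      D-+                  : ∀ x y → D (x + y) ≈ D x + D y
      D-*                  : ∀ x y → D (x * y) ≈ D x * y + η x * D y
      D-ι                  : ∀ k → D (ι k) ≈ 0#
      𝕏                    : A
      η-𝕏                  : η 𝕏 ≈ 0#
      D-𝕏                  : D 𝕏 ≈ 1#
      affine-unique        : ∀ s t {x y} → η x ≈ η y → D x ≈ s * x + t → D y ≈ s * y + t → x ≈ y
      inverse              : ∀ x → η x ≈ 1# → ∃[ y ] y * x ≈ 1#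

    open Evaluation rawRing ι

    SolvesIVP : ∀ {m} → Vector (Poly (suc m)) m → Vector Carrier m → Vector A m → Set ℓ
    SolvesIVP P r ζ = (∀ i → D (ζ i) ≈ ⟦ P i ⟧ (𝕏 ◂ ζ)) × (∀ i → η (ζ i) ≈ ι (r i))

    field
      ivp-solvable         : ∀ {m} (P : Vector (Poly (suc m)) m) r → ∃[ ζ ] SolvesIVP P r ζ
      ivp-unique           : ∀ {m} (P : Vector (Poly (suc m)) m) r {ζ ζ′} → SolvesIVP P r ζ → SolvesIVP P r ζ′ → ∀ i → ζ i ≈ ζ′ i

  -- The chain rule for the syntactic stream derivative.

  module ChainRule {a ℓ} (𝒮 : StreamAlgebra a ℓ) where
    open StreamAlgebra 𝒮 hiding (ring)
    open CommutativeRing (StreamAlgebra.ring 𝒮) hiding (zero) renaming (Carrier to A)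
    open PolynomialEvaluation (StreamAlgebra.ring 𝒮) ι-isRingHomomorphism
    open Evaluation rawRing ι
    open Algebra.Definitions.RawSemiring (RawRing.rawSemiring rawRing) using (sum; product; _^_)
    open Relation.Binary.Reasoning.Setoid setoid
    private
      module K = CommutativeRing fieldRing
      module ι = IsRingHomomorphism ι-isRingHomomorphism

    D-0 : D 0# ≈ 0#
    D-0 = trans (D-cong (sym ι.0#-homo)) (D-ι K.0#)

    D-1 : D 1# ≈ 0#
    D-1 = trans (D-cong (sym ι.1#-homo)) (D-ι K.1#)

    D-ι* : ∀ k x → D (ι k * x) ≈ ι k * D x
    D-ι* k x = begin
      D (ι k * x)                  ≈⟨ D-* (ι k) x ⟩
      D (ι k) * x + η (ι k) * D x  ≈⟨ +-cong (trans (*-congʳ (D-ι k)) (zeroˡ x)) (*-congʳ (η-ι k)) ⟩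
      0# + ι k * D x               ≈⟨ +-identityˡ _ ⟩
      ι k * D x                    ∎

    module _ {n : ℕ} (y : Vector A n) where
      v : Vector A (suc n)
      v = 𝕏 ◂ y

      y₀ y′ : Vector A n
      y₀ i = η (y i)
      y′ i = D (y i)

      full : Vector A (suc n ℕ.+ n ℕ.+ n)
      full = (v ⊕ y₀) ⊕ y′

      ⟦base⟧ : ∀ i → ⟦ base i ⟧ full ≈ v i
      ⟦base⟧ i = trans (⟦⟧-var full ((i ↑ˡ n) ↑ˡ n))
        (reflexive (≡.trans (lookup-++ˡ (v ⊕ y₀) y′ (i ↑ˡ n)) (lookup-++ˡ v y₀ i)))

      ⟦initial⟧ : ∀ i → ⟦ initial i ⟧ full ≈ η (v i)
      ⟦initial⟧ zero    = sym η-𝕏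
      ⟦initial⟧ (suc i) = trans (⟦⟧-var full ((suc n ↑ʳ i) ↑ˡ n))
        (reflexive (≡.trans (lookup-++ˡ (v ⊕ y₀) y′ (suc n ↑ʳ i)) (lookup-++ʳ v y₀ i)))

      ⟦derived⟧ : ∀ i → ⟦ derived i ⟧ full ≈ D (v i)
      ⟦derived⟧ zero    = trans (⟦⟧-1 full) (sym D-𝕏)
      ⟦derived⟧ (suc i) = trans (⟦⟧-var full ((suc n ℕ.+ n) ↑ʳ i)) (reflexive (lookup-++ʳ (v ⊕ y₀) y′ i))

      wordValue : List (Fin (suc n)) → A
      wordValue = foldr (λ u x → v u * x) 1#

      ⟦word⟧ : ∀ w → ⟦ foldr (λ u q → base u *ᵖ q) 1ᵖ w ⟧ full ≈ wordValue w
      ⟦word⟧ []      = ⟦⟧-1 full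
      ⟦word⟧ (u ∷ w) = trans (⟦⟧-* (base u) (foldr (λ u q → base u *ᵖ q) 1ᵖ w) full) (*-cong (⟦base⟧ u) (⟦word⟧ w))

      -- The clause of `derivWord` for longer words mirrors the product rule `D-*`, with the least
      -- variable as the left factor, the one whose initial value is taken.
      ⟦derivWord⟧ : ∀ w → ⟦ derivWord w ⟧ full ≈ D (wordValue w)
      ⟦derivWord⟧ []              = sym D-1
      ⟦derivWord⟧ (u ∷ [])        = trans (⟦derived⟧ u) (D-cong (sym (*-identityʳ _)))
      ⟦derivWord⟧ (u ∷ w@(_ ∷ _)) = begin
        ⟦ derivWord (u ∷ w) ⟧ full
          ≈⟨ ⟦⟧-+ (derived u *ᵖ foldr (λ u q → base u *ᵖ q) 1ᵖ w) (initial u *ᵖ derivWord w) full ⟩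
        ⟦ derived u *ᵖ foldr (λ u q → base u *ᵖ q) 1ᵖ w ⟧ full + ⟦ initial u *ᵖ derivWord w ⟧ full
          ≈⟨ +-cong (⟦⟧-* (derived u) (foldr (λ u q → base u *ᵖ q) 1ᵖ w) full) (⟦⟧-* (initial u) (derivWord w) full) ⟩
        ⟦ derived u ⟧ full * ⟦ foldr (λ u q → base u *ᵖ q) 1ᵖ w ⟧ full + ⟦ initial u ⟧ full * ⟦ derivWord w ⟧ full
          ≈⟨ +-cong (*-cong (⟦derived⟧ u) (⟦word⟧ w)) (*-cong (⟦initial⟧ u) (⟦derivWord⟧ w)) ⟩
        D (v u) * wordValue w + η (v u) * D (wordValue w)
          ≈⟨ D-* (v u) (wordValue w) ⟨
        D (wordValue (u ∷ w)) ∎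

      wordValue-replicate : ∀ e i w → wordValue (replicate e i ++ˡ w) ≈ v i ^ e * wordValue w
      wordValue-replicate zero    i w = sym (*-identityˡ _)
      wordValue-replicate (suc e) i w = trans (*-congˡ (wordValue-replicate e i w)) (sym (*-assoc _ _ _))

      -- Only the case where `f` is the identity is wanted; the induction passes to `f ∘ suc`, hence
      -- the generality.
      wordValue-concat : ∀ {k} (e : Fin k → ℕ) (f : Fin k → Fin (suc n)) →
        wordValue (concat (tabulate λ i → replicate (e i) (f i))) ≈ product (λ i → v (f i) ^ e i)
      wordValue-concat {zero}  e f = refl
      wordValue-concat {suc k} e f = trans (wordValue-replicate (e zero) (f zero) _)
        (*-congˡ (wordValue-concat (e ∘ suc) (f ∘ suc)))

      ⟦deriv⟧ : ∀ p → ⟦ deriv p ⟧ full ≈ D (⟦ p ⟧ v)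
      ⟦deriv⟧ []            = sym D-0
      ⟦deriv⟧ ((k , μ) ∷ p) = begin
        ⟦ deriv ((k , μ) ∷ p) ⟧ full
          ≈⟨ ⟦⟧-+ (k ·ᵖ derivWord (word μ)) (deriv p) full ⟩
        ⟦ k ·ᵖ derivWord (word μ) ⟧ full + ⟦ deriv p ⟧ full
          ≈⟨ +-cong (⟦⟧-· k (derivWord (word μ)) full) (⟦deriv⟧ p) ⟩
        ι k * ⟦ derivWord (word μ) ⟧ full + D (⟦ p ⟧ v)
          ≈⟨ +-congʳ (*-congˡ (trans (⟦derivWord⟧ (word μ)) (D-cong (wordValue-concat (Vec.lookup μ) (λ i → i))))) ⟩
        ι k * D (monomial v μ) + D (⟦ p ⟧ v)
          ≈⟨ +-congʳ (D-ι* k (monomial v μ)) ⟨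
        D (ι k * monomial v μ) + D (⟦ p ⟧ v)
          ≈⟨ D-+ _ _ ⟨
        D (ι k * monomial v μ + ⟦ p ⟧ v) ∎

      -- A term selected for `q₀` contains no `y′`, which excludes the second alternative of
      -- `deriv-shape`. This is what allows `ð/ðx p` to replace `q₀ p`.
      q₀-noY₀ : ∀ p → All (λ t → Vec.drop (suc n) (proj₂ t) ≡ 1ᵐ) (q₀ {n} p)
      q₀-noY₀ p = All.map⁺ (All.zipWith (λ {t} → noY₀ t) (All.all-filter noY′? (deriv p) , All.filter⁺ noY′? (deriv-shape p)))
        where
        Y₀ Y′ : Carrier × Monomial (suc n ℕ.+ n ℕ.+ n) → Monomial n
        Y₀ t = Vec.drop (suc n) (Vec.take (suc n ℕ.+ n) (proj₂ t))
        Y′ t = Vec.drop (suc n ℕ.+ n) (proj₂ t)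
        noY′? : ∀ t → Dec (Y′ t ≡ 1ᵐ)
        noY′? t = Vec.≡-dec ℕ._≟_ (Y′ t) 1ᵐ
        noY₀ : ∀ t → Y′ t ≡ 1ᵐ × ((Y₀ t ≡ 1ᵐ × Y′ t ≡ 1ᵐ) ⊎ (∃[ i ] Y′ t ≡ varᵐ i)) → Y₀ t ≡ 1ᵐ
        noY₀ t (_   , inj₁ (eq , _)) = eq
        noY₀ t (eq′ , inj₂ (i , eq)) = contradiction (≡.trans (≡.sym eq) eq′) (varᵐ≢1ᵐ i)

      -- The syntactic derivative, evaluated with `y₀` at the initial values and `y′` at the
      -- derivatives, is the derivative of the value; being affine in `y′`, it splits into the two
      -- parts.
      chainRule : ∀ p → D (⟦ p ⟧ (𝕏 ◂ y)) ≈ ⟦ ð/ðx p ⟧ (𝕏 ◂ y) + sum (λ i → ⟦ ð/ðy i p ⟧ ((𝕏 ◂ y) ⊕ (η ∘ y)) * D (y i))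
      chainRule p = begin
        D (⟦ p ⟧ v)                                                       ≈⟨ ⟦deriv⟧ p ⟨
        ⟦ deriv p ⟧ full                                                  ≈⟨ ⟦⟧-affine (suc n ℕ.+ n) (All.map shape (deriv-shape p)) (v ⊕ y₀) y′ ⟩
        ⟦ q₀ p ⟧ (v ⊕ y₀) + sum (λ i → ⟦ ð/ðy i p ⟧ (v ⊕ y₀) * y′ i)     ≈⟨ +-congʳ (⟦⟧-constant (suc n) (q₀-noY₀ p) v y₀) ⟩
        ⟦ ð/ðx p ⟧ v + sum (λ i → ⟦ ð/ðy i p ⟧ (v ⊕ y₀) * y′ i)          ∎
        where
        shape : ∀ {a b c} {P : Set a} {Q : Set b} {R : Set c} → (P × Q) ⊎ R → Q ⊎ R
        shape (inj₁ (_ , q)) = inj₁ q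
        shape (inj₂ r)       = inj₂ r

  -- The ring of streams and causal differential equations.

  module Streams where
    private
      module K = CommutativeRing fieldRing
    open K using (_≈_; _+_; _*_; -_; 0#; 1#)
    open RawRing streamRawRing using () renaming (_+_ to _+ˢ_; _*_ to _*ˢ_; 1# to 1ˢ)
    open Algebra.Properties.Semiring.Sum K.semiring using (sum; sum-cong-≋; sum-replicate-zero)
    open Algebra.Properties.CommutativeSemigroup K.+-commutativeSemigroup using (interchange; x∙yz≈y∙xz)
    open Algebra.Properties.Ring K.ring using (-0#≈0#)
    open Relation.Binary.Reasoning.Setoid K.setoid

    const-0 : ∀ i → const 0# i ≈ 0#
    const-0 zero    = K.refl
    const-0 (suc i) = K.refl

    const-+ : ∀ k l i → const (k + l) i ≈ const k i + const l i
    const-+ k l zero    = K.refl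
    const-+ k l (suc i) = K.sym (K.+-identityˡ _)

    const-neg : ∀ k i → const (- k) i ≈ - const k i
    const-neg k zero    = K.refl
    const-neg k (suc i) = K.sym -0#≈0#

    const-cong : ∀ {k l} → k ≈ l → const k ≈ˢ const l
    const-cong k≈l zero    = k≈l
    const-cong k≈l (suc i) = K.refl

    infix 4 _≈[_]_
    _≈[_]_ : Stream → ℕ → Stream → Set ℓ₁
    σ ≈[ k ] τ = ∀ j → j ℕ.≤ k → σ j ≈ τ j

    *ˢ-causal : ∀ {k σ σ′ τ τ′} → σ ≈[ k ] σ′ → τ ≈[ k ] τ′ → (σ *ˢ τ) ≈[ k ] (σ′ *ˢ τ′)
    *ˢ-causal {k} σ≈ τ≈ i i≤k = sum-cong-≋ {suc i} λ j →
      K.*-cong (σ≈ (toℕ j) (ℕ.≤-trans (ℕ.≤-pred (Fin.toℕ<n j)) i≤k)) (τ≈ (i ∸ toℕ j) (ℕ.≤-trans (ℕ.m∸n≤m i (toℕ j)) i≤k))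

    *ˢ-cong : ∀ {σ σ′ τ τ′} → σ ≈ˢ σ′ → τ ≈ˢ τ′ → (σ *ˢ τ) ≈ˢ (σ′ *ˢ τ′)
    *ˢ-cong {σ} {σ′} {τ} {τ′} σ≈ τ≈ i = *ˢ-causal {i} {σ} {σ′} {τ} {τ′} (λ j _ → σ≈ j) (λ j _ → τ≈ j) i ℕ.≤-refl

    *ˢ-zeroˡ : ∀ τ i → ((λ _ → 0#) *ˢ τ) i ≈ 0#
    *ˢ-zeroˡ τ i = K.trans (sum-cong-≋ {suc i} λ j → K.zeroˡ (τ (i ∸ toℕ j))) (sum-replicate-zero (suc i))

    const-*ˢ : ∀ k τ i → (const k *ˢ τ) i ≈ k * τ i
    const-*ˢ k τ zero    = K.+-identityʳ _
    const-*ˢ k τ (suc i) = K.trans (K.+-congˡ (*ˢ-zeroˡ τ i)) (K.+-identityʳ _)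

    const-* : ∀ k l i → const (k * l) i ≈ (const k *ˢ const l) i
    const-* k l i = K.trans (lemma i) (K.sym (const-*ˢ k (const l) i))
      where
      lemma : ∀ i → const (k * l) i ≈ k * const l i
      lemma zero    = K.refl
      lemma (suc i) = K.sym (K.zeroʳ k)

    -- Convolution satisfies `(σ *ˢ τ) (suc i) = σ 0 * τ (suc i) + ((σ ′) *ˢ τ) i` by mere unfolding
    -- of the sum. The ring laws therefore go by induction on the index, with the streams left
    -- general because `σ` becomes `σ ′`.
    *ˢ-distribʳ : ∀ υ σ τ i → ((σ +ˢ τ) *ˢ υ) i ≈ (σ *ˢ υ) i + (τ *ˢ υ) i
    *ˢ-distribʳ υ σ τ zero = begin
      (σ 0 + τ 0) * υ 0 + 0#           ≈⟨ K.+-cong (K.distribʳ _ _ _) (K.sym (K.+-identityˡ _)) ⟩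
      σ 0 * υ 0 + τ 0 * υ 0 + (0# + 0#)  ≈⟨ interchange _ _ _ _ ⟩
      σ 0 * υ 0 + 0# + (τ 0 * υ 0 + 0#)  ∎
    *ˢ-distribʳ υ σ τ (suc i) = begin
      (σ 0 + τ 0) * υ (suc i) + (((σ ′) +ˢ (τ ′)) *ˢ υ) i  ≈⟨ K.+-cong (K.distribʳ _ _ _) (*ˢ-distribʳ υ (σ ′) (τ ′) i) ⟩
      _                                                  ≈⟨ interchange _ _ _ _ ⟩
      (σ *ˢ υ) (suc i) + (τ *ˢ υ) (suc i)                  ∎

    scale-*ˢ : ∀ k σ τ i → ((λ j → k * σ j) *ˢ τ) i ≈ k * (σ *ˢ τ) i
    scale-*ˢ k σ τ i = K.trans (sum-cong-≋ {suc i} λ j → K.*-assoc k (σ (toℕ j)) (τ (i ∸ toℕ j)))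
      (K.sym (*-distribˡ-sum {suc i} k λ j → σ (toℕ j) * τ (i ∸ toℕ j)))
      where open Algebra.Properties.Semiring.Sum K.semiring using (*-distribˡ-sum)

    *ˢ-assoc : ∀ σ τ υ i → ((σ *ˢ τ) *ˢ υ) i ≈ (σ *ˢ (τ *ˢ υ)) i
    *ˢ-assoc σ τ υ zero = begin
      (σ 0 * τ 0 + 0#) * υ 0 + 0#    ≈⟨ K.+-congʳ (K.*-congʳ (K.+-identityʳ _)) ⟩
      σ 0 * τ 0 * υ 0 + 0#           ≈⟨ K.+-congʳ (K.trans (K.*-assoc _ _ _) (K.*-congˡ (K.sym (K.+-identityʳ _)))) ⟩
      σ 0 * (τ 0 * υ 0 + 0#) + 0#    ∎
    *ˢ-assoc σ τ υ (suc i) = begin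
      (σ 0 * τ 0 + 0#) * υ (suc i) + (((σ *ˢ τ) ′) *ˢ υ) i
        ≈⟨ K.+-cong (K.trans (K.*-congʳ (K.+-identityʳ _)) (K.*-assoc _ _ _)) (*ˢ-distribʳ υ (λ j → σ 0 * τ (suc j)) ((σ ′) *ˢ τ) i) ⟩
      σ 0 * (τ 0 * υ (suc i)) + (((λ j → σ 0 * τ (suc j)) *ˢ υ) i + (((σ ′) *ˢ τ) *ˢ υ) i)
        ≈⟨ K.+-congˡ (K.+-cong (scale-*ˢ (σ 0) (τ ′) υ i) (*ˢ-assoc (σ ′) τ υ i)) ⟩
      σ 0 * (τ 0 * υ (suc i)) + (σ 0 * ((τ ′) *ˢ υ) i + ((σ ′) *ˢ (τ *ˢ υ)) i)
        ≈⟨ K.+-assoc _ _ _ ⟨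
      σ 0 * (τ 0 * υ (suc i)) + σ 0 * ((τ ′) *ˢ υ) i + ((σ ′) *ˢ (τ *ˢ υ)) i
        ≈⟨ K.+-congʳ (K.distribˡ _ _ _) ⟨
      σ 0 * (τ *ˢ υ) (suc i) + ((σ ′) *ˢ (τ *ˢ υ)) i ∎

    -- Splits off the last summand where unfolding splits off the first. Commutativity exchanges
    -- these two recursions.
    *ˢ-sucʳ : ∀ σ τ i → (σ *ˢ τ) (suc i) ≈ σ (suc i) * τ 0 + (σ *ˢ (τ ′)) i
    *ˢ-sucʳ σ τ zero    = x∙yz≈y∙xz _ _ _
    *ˢ-sucʳ σ τ (suc i) = begin
      σ 0 * τ (suc (suc i)) + ((σ ′) *ˢ τ) (suc i)
        ≈⟨ K.+-congˡ (*ˢ-sucʳ (σ ′) τ i) ⟩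
      σ 0 * τ (suc (suc i)) + (σ (suc (suc i)) * τ 0 + ((σ ′) *ˢ (τ ′)) i)
        ≈⟨ x∙yz≈y∙xz _ _ _ ⟩
      σ (suc (suc i)) * τ 0 + (σ *ˢ (τ ′)) (suc i) ∎

    *ˢ-comm : ∀ σ τ i → (σ *ˢ τ) i ≈ (τ *ˢ σ) i
    *ˢ-comm σ τ zero    = K.+-congʳ (K.*-comm _ _)
    *ˢ-comm σ τ (suc i) = begin
      σ 0 * τ (suc i) + ((σ ′) *ˢ τ) i  ≈⟨ K.+-cong (K.*-comm _ _) (*ˢ-comm (σ ′) τ i) ⟩
      τ (suc i) * σ 0 + (τ *ˢ (σ ′)) i  ≈⟨ *ˢ-sucʳ τ σ i ⟨
      (τ *ˢ σ) (suc i)                  ∎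

    *ˢ-identityˡ : ∀ σ i → (1ˢ *ˢ σ) i ≈ σ i
    *ˢ-identityˡ σ i = K.trans (const-*ˢ 1# σ i) (K.*-identityˡ _)

    streamRing : CommutativeRing c ℓ₁
    streamRing = record
      { RawRing streamRawRing
      ; isCommutativeRing = record
        { isRing = record
          { +-isAbelianGroup = record
            { isGroup = record
              { isMonoid = record
                { isSemigroup = record
                  { isMagma = record
                    { isEquivalence = record
                      { refl  = λ _ → K.refl
                      ; sym   = λ p i → K.sym (p i)
                      ; trans = λ p q i → K.trans (p i) (q i)
                      }
                    ; ∙-cong = λ p q i → K.+-cong (p i) (q i)
                    }
                  ; assoc = λ σ τ υ i → K.+-assoc _ _ _
                  }
                ; identity = (λ σ i → K.trans (K.+-congʳ (const-0 i)) (K.+-identityˡ _))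
                           , (λ σ i → K.trans (K.+-congˡ (const-0 i)) (K.+-identityʳ _))
                }
              ; inverse = (λ σ i → K.trans (K.-‿inverseˡ _) (K.sym (const-0 i)))
                        , (λ σ i → K.trans (K.-‿inverseʳ _) (K.sym (const-0 i)))
              ; ⁻¹-cong = λ p i → K.-‿cong (p i)
              }
            ; comm = λ σ τ i → K.+-comm _ _
            }
          ; *-cong = λ {σ} {σ′} {τ} {τ′} → *ˢ-cong {σ} {σ′} {τ} {τ′}
          ; *-assoc = *ˢ-assoc
          ; *-identity = *ˢ-identityˡ , (λ σ i → K.trans (*ˢ-comm σ 1ˢ i) (*ˢ-identityˡ σ i))
          ; distrib = (λ υ σ τ i → K.trans (*ˢ-comm υ (σ +ˢ τ) i)
                        (K.trans (*ˢ-distribʳ υ σ τ i) (K.+-cong (*ˢ-comm σ υ i) (*ˢ-comm τ υ i))))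
                    , *ˢ-distribʳ
          }
        ; *-comm = *ˢ-comm
        }
      }

    const-isRingHomomorphism : IsRingHomomorphism (fieldRawRing F) streamRawRing const
    const-isRingHomomorphism = record
      { isSemiringHomomorphism = record
        { isNearSemiringHomomorphism = record
          { +-isMonoidHomomorphism = record
            { isMagmaHomomorphism = record
              { isRelHomomorphism = record { cong = const-cong }
              ; homo              = const-+
              }
            ; ε-homo = λ _ → K.refl
            }
          ; *-homo = const-*
          }
        ; 1#-homo = λ _ → K.refl
        }
      ; -‿homo = const-neg
      }

    initialValue : Stream → Stream
    initialValue σ = const (σ 0)

    initialValue-isRingHomomorphism : IsRingHomomorphism streamRawRing streamRawRing initialValue
    initialValue-isRingHomomorphism = record
      { isSemiringHomomorphism = record
        { isNearSemiringHomomorphism = record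
          { +-isMonoidHomomorphism = record
            { isMagmaHomomorphism = record
              { isRelHomomorphism = record { cong = λ p → const-cong (p 0) }
              ; homo              = λ σ τ → const-+ (σ 0) (τ 0)
              }
            ; ε-homo = λ _ → K.refl
            }
          ; *-homo = λ σ τ i → K.trans (const-cong (K.+-identityʳ (σ 0 * τ 0)) i) (const-* (σ 0) (τ 0) i)
          }
        ; 1#-homo = λ _ → K.refl
        }
      ; -‿homo = λ σ → const-neg (σ 0)
      }

    ′-* : ∀ σ τ → ((σ *ˢ τ) ′) ≈ˢ (((σ ′) *ˢ τ) +ˢ (initialValue σ *ˢ (τ ′)))
    ′-* σ τ i = K.trans (K.+-comm _ _) (K.+-congˡ (K.sym (const-*ˢ (σ 0) (τ ′) i)))

    module CausalEquation {m} (Φ : Vector Stream m → Vector Stream m)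
      (causal : ∀ k {ρ ρ′} → (∀ i → ρ i ≈[ k ] ρ′ i) → ∀ i → Φ ρ i ≈[ k ] Φ ρ′ i)
      (r : Vector Carrier m) where

      Solution : Vector Stream m → Set ℓ₁
      Solution ρ = (∀ i → (ρ i ′) ≈ˢ Φ ρ i) × HasInitialValue ρ r

      -- Agreement of all components up to index `k` passes through `Φ` by causality, and the
      -- equation shifts it to index `k + 1`.
      solutions-agree : ∀ {ρ ρ′} → Solution ρ → Solution ρ′ → ∀ k i → ρ i ≈[ k ] ρ′ i
      solutions-agree (_ , ρ₀) (_ , ρ′₀) k       i zero    _           = K.trans (ρ₀ i) (K.sym (ρ′₀ i))
      solutions-agree sol@(ρ′ , _) sol′@(ρ′′ , _) (suc k) i (suc j) (ℕ.s≤s j≤k) =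
        K.trans (ρ′ i j) (K.trans (causal k (solutions-agree sol sol′ k) i j j≤k) (K.sym (ρ′′ i j)))

      solution-unique : ∀ {ρ ρ′} → Solution ρ → Solution ρ′ → ρ ≈ˢⱽ ρ′
      solution-unique sol sol′ i j = solutions-agree sol sol′ j i j ℕ.≤-refl

      -- Picard iteration. Iterate `k` is final up to index `k`, so the diagonal is the solution; of
      -- the starting stream only the entry at 0 matters.
      approx : ℕ → Vector Stream m
      approx zero    i = const (r i)
      approx (suc k) i zero    = r i
      approx (suc k) i (suc j) = Φ (approx k) i j

      approx-step : ∀ k i → approx k i ≈[ k ] approx (suc k) i
      approx-step zero    i zero    _           = K.refl
      approx-step (suc k) i zero    _           = K.refl
      approx-step (suc k) i (suc j) (ℕ.s≤s j≤k) = causal k (approx-step k) i j j≤k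

      solution : Vector Stream m
      solution i j = approx j i j

      solution-approx : ∀ k i → solution i ≈[ k ] approx k i
      solution-approx zero    i zero _ = K.refl
      solution-approx (suc k) i j j≤1+k with ℕ.m≤n⇒m<n∨m≡n j≤1+k
      ... | inj₁ (ℕ.s≤s j≤k) = K.trans (solution-approx k i j j≤k) (approx-step k i j j≤k)
      ... | inj₂ ≡.refl      = K.refl

      solution-solves : Solution solution
      -- Entry `suc j` of the solution is `Φ (approx j) i j` by definition, and causality allows
      -- `approx j` to be replaced by the solution, which agrees with it up to `j`.
      solution-solves = (λ i j → K.sym (causal j (solution-approx j) i j ℕ.≤-refl)) , (λ i → K.refl)

    ⟦⟧-causal : ∀ {m} k (p : Poly m) {ρ ρ′} → (∀ i → ρ i ≈[ k ] ρ′ i) → ⟦ p ⟧ˢ ρ ≈[ k ] ⟦ p ⟧ˢ ρ′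
    ⟦⟧-causal k = EvaluationRelation.⟦⟧-related streamRawRing const streamRawRing const {_~_ = _≈[ k ]_}
      (λ _ _ → K.refl) (λ _ _ → K.refl) (λ p q j j≤k → K.+-cong (p j j≤k) (q j j≤k))
      (λ {σ} {τ} {σ′} {τ′} → *ˢ-causal {k} {σ} {σ′} {τ} {τ′}) (λ _ _ _ → K.refl)

    ivp-causal : ∀ {m} (P : Vector (Poly (suc m)) m) k {ρ ρ′} → (∀ i → ρ i ≈[ k ] ρ′ i) →
      ∀ i → ⟦ P i ⟧ˢ (X ◂ ρ) ≈[ k ] ⟦ P i ⟧ˢ (X ◂ ρ′)
    ivp-causal P k {ρ} {ρ′} ρ≈ρ′ i = ⟦⟧-causal k (P i) pointwise
      where
      pointwise : ∀ i → (X ◂ ρ) i ≈[ k ] (X ◂ ρ′) i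
      pointwise zero    _ _ = K.refl
      pointwise (suc i)     = ρ≈ρ′ i

    -- The coefficients are arbitrary streams, so this is no polynomial problem, but the right-hand
    -- side is causal all the same.
    affine-unique : ∀ α β {σ τ} → initialValue σ ≈ˢ initialValue τ →
      (σ ′) ≈ˢ ((α *ˢ σ) +ˢ β) → (τ ′) ≈ˢ ((α *ˢ τ) +ˢ β) → σ ≈ˢ τ
    affine-unique α β {σ} {τ} σ₀≈τ₀ σ′≈ τ′≈ =
      CausalEquation.solution-unique {m = 1} (λ ρ i → (α *ˢ ρ i) +ˢ β)
        (λ k {ρ} {ρ′} ρ≈ρ′ i j j≤k → K.+-congʳ (*ˢ-causal {k} {α} {α} {ρ i} {ρ′ i} (λ _ _ → K.refl) (ρ≈ρ′ i) j j≤k))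
        (λ _ → τ 0) {λ _ → σ} {λ _ → τ} ((λ _ → σ′≈) , (λ _ → σ₀≈τ₀ 0)) ((λ _ → τ′≈) , (λ _ → K.refl)) zero

    -- If `σ τ = 1` and `σ(0) = 1`, the product rule forces `τ′ = −σ′ τ`. This equation is causal in
    -- `τ`, and its solution with initial value 1 is the reciprocal.
    inverse : ∀ σ → initialValue σ ≈ˢ 1ˢ → ∃[ τ ] (τ *ˢ σ) ≈ˢ 1ˢ
    inverse σ σ₀≈1 = τ , λ i → K.trans (*ˢ-comm τ σ i) (στ≈1 i)
      where
      open CausalEquation {m = 1} (λ ρ i j → - ((σ ′) *ˢ ρ i) j)
        (λ k {ρ} {ρ′} ρ≈ρ′ i j j≤k → K.-‿cong (*ˢ-causal {k} {σ ′} {σ ′} {ρ i} {ρ′ i} (λ _ _ → K.refl) (ρ≈ρ′ i) j j≤k))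
        (λ _ → 1#)
      τ : Stream
      τ = solution zero
      στ≈1 : (σ *ˢ τ) ≈ˢ 1ˢ
      στ≈1 zero    = K.trans (K.+-identityʳ _) (K.trans (K.*-congʳ (σ₀≈1 0)) (K.*-identityˡ _))
      στ≈1 (suc i) = begin
        σ 0 * τ (suc i) + ((σ ′) *ˢ τ) i       ≈⟨ K.+-congʳ (K.trans (K.*-congʳ (σ₀≈1 0)) (K.*-identityˡ _)) ⟩
        τ (suc i) + ((σ ′) *ˢ τ) i             ≈⟨ K.+-congʳ (proj₁ solution-solves zero i) ⟩
        - ((σ ′) *ˢ τ) i + ((σ ′) *ˢ τ) i      ≈⟨ K.-‿inverseˡ _ ⟩
        0#                                   ∎

    module _ {m} (P : Vector (Poly (suc m)) m) (r : Vector Carrier m) where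
      open CausalEquation (λ ζ i → ⟦ P i ⟧ˢ (X ◂ ζ)) (ivp-causal P) r

      ivp-solvable : ∃[ ζ ] (∀ i → (ζ i ′) ≈ˢ ⟦ P i ⟧ˢ (X ◂ ζ)) × (∀ i → initialValue (ζ i) ≈ˢ const (r i))
      ivp-solvable = solution , proj₁ solution-solves , λ i → const-cong (proj₂ solution-solves i)

      ivp-unique : ∀ {ζ ζ′} →
        (∀ i → (ζ i ′) ≈ˢ ⟦ P i ⟧ˢ (X ◂ ζ)) × (∀ i → initialValue (ζ i) ≈ˢ const (r i)) →
        (∀ i → (ζ′ i ′) ≈ˢ ⟦ P i ⟧ˢ (X ◂ ζ′)) × (∀ i → initialValue (ζ′ i) ≈ˢ const (r i)) → ζ ≈ˢⱽ ζ′
      ivp-unique (D-ζ , η-ζ) (D-ζ′ , η-ζ′) = solution-unique (D-ζ , λ i → η-ζ i 0) (D-ζ′ , λ i → η-ζ′ i 0)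

    streamAlgebra : StreamAlgebra c ℓ₁
    streamAlgebra = record
      { ring                 = streamRing
      ; ι                    = const
      ; ι-isRingHomomorphism = const-isRingHomomorphism
      ; η                    = initialValue
      ; η-isRingHomomorphism = initialValue-isRingHomomorphism
      ; η-ι                  = λ _ _ → K.refl
      ; D                    = _′
      ; D-cong               = λ p i → p (suc i)
      ; D-+                  = λ _ _ _ → K.refl
      ; D-*                  = ′-*
      ; D-ι                  = λ _ i → K.sym (const-0 i)
      ; 𝕏                    = X
      ; η-𝕏                  = λ _ → K.refl
      ; D-𝕏                  = X′≈1
      ; affine-unique        = affine-unique
      ; inverse              = inverse
      ; ivp-solvable         = ivp-solvable
      ; ivp-unique           = ivp-unique
      }
      where
      X′≈1 : (X ′) ≈ˢ 1ˢ
      X′≈1 zero    = K.refl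
      X′≈1 (suc i) = K.refl

  -- The implicit function theorem in a stream algebra.

  module ImplicitFunction {a ℓ} (𝒮 : StreamAlgebra a ℓ) where
    open StreamAlgebra 𝒮 hiding (ring)
    open CommutativeRing (StreamAlgebra.ring 𝒮) hiding (zero) renaming (Carrier to A)
    open PolynomialEvaluation (StreamAlgebra.ring 𝒮) ι-isRingHomomorphism
    open ChainRule 𝒮 using (D-0; D-1; chainRule)
    open Evaluation rawRing ι
    open MatrixProperties (StreamAlgebra.ring 𝒮)
    open Algebra.Properties.Semiring.Sum semiring using (sum; sum-cong-≋)
    open Algebra.Properties.Ring ring using (-‿distribˡ-*; -‿distribʳ-*; +-inverseʳ-unique)
    open Algebra.Properties.CommutativeSemigroup *-commutativeSemigroup using (x∙yz≈y∙xz)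
    open Relation.Binary.Reasoning.Setoid setoid
    private
      S : CommutativeRing a ℓ
      S = StreamAlgebra.ring 𝒮
      module K = CommutativeRing fieldRing
      module ι = IsRingHomomorphism ι-isRingHomomorphism
      module η = IsRingHomomorphism η-isRingHomomorphism

    ⟦⟧-cong : ∀ {m} (p : Poly m) {ρ ρ′} → (∀ i → ρ i ≈ ρ′ i) → ⟦ p ⟧ ρ ≈ ⟦ p ⟧ ρ′
    ⟦⟧-cong = EvaluationRelation.⟦⟧-related rawRing ι rawRing ι {_~_ = _≈_} refl refl +-cong *-cong (λ _ → refl)

    ⟦⟧-η : ∀ {m} (p : Poly m) ρ → η (⟦ p ⟧ ρ) ≈ ⟦ p ⟧ (η ∘ ρ)
    ⟦⟧-η p ρ = EvaluationRelation.⟦⟧-related rawRing ι rawRing ι {_~_ = λ x y → η x ≈ y} η.0#-homo η.1#-homo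
      (λ x≈ y≈ → trans (η.+-homo _ _) (+-cong x≈ y≈)) (λ x≈ y≈ → trans (η.*-homo _ _) (*-cong x≈ y≈)) η-ι p (λ _ → refl)

    ⟦⟧-ι : ∀ {m} (p : Poly m) r → ι (⟦ p ⟧ᴷ r) ≈ ⟦ p ⟧ (ι ∘ r)
    ⟦⟧-ι p r = EvaluationRelation.⟦⟧-related (fieldRawRing F) (λ k → k) rawRing ι {_~_ = λ k x → ι k ≈ x} ι.0#-homo ι.1#-homo
      (λ x≈ y≈ → trans (ι.+-homo _ _) (+-cong x≈ y≈)) (λ x≈ y≈ → trans (ι.*-homo _ _) (*-cong x≈ y≈)) (λ _ → refl) p (λ _ → refl)

    substᵖ : ∀ {m k} → Vector (Poly k) m → Poly m → Poly k
    substᵖ {k = k} θ p = Evaluation.⟦_⟧ (polyRawRing k) constᵖ p θ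

    ⟦substᵖ⟧ : ∀ {m k} (θ : Vector (Poly k) m) p ρ → ⟦ substᵖ θ p ⟧ ρ ≈ ⟦ p ⟧ (λ i → ⟦ θ i ⟧ ρ)
    ⟦substᵖ⟧ {k = k} θ p ρ = EvaluationRelation.⟦⟧-related (polyRawRing k) constᵖ rawRing ι {_~_ = λ q x → ⟦ q ⟧ ρ ≈ x} refl (⟦⟧-1 ρ)
      (λ {q} {q′} x≈ y≈ → trans (⟦⟧-+ q q′ ρ) (+-cong x≈ y≈)) (λ {q} {q′} x≈ y≈ → trans (⟦⟧-* q q′ ρ) (*-cong x≈ y≈))
      (λ k → ⟦⟧-const k ρ) p (λ _ → refl)

    *ⱽ-neg : ∀ {n} (M : Matrix n) u i → (M *ⱽ (λ j → - u j)) i ≈ - (M *ⱽ u) i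
    *ⱽ-neg M u i = begin
      (M *ⱽ (λ j → - u j)) i       ≈⟨ *ⱽ-cong {M = M} (λ _ _ → refl) (λ j → -1*x≈-x (u j)) i ⟨
      (M *ⱽ (λ j → - 1# * u j)) i  ≈⟨ *ⱽ-scale (- 1#) M u i ⟩
      - 1# * (M *ⱽ u) i            ≈⟨ -1*x≈-x _ ⟩
      - (M *ⱽ u) i                 ∎
      where open Algebra.Properties.Ring ring using (-1*x≈-x)

    module _ {n : ℕ} (E : Vector (Poly (suc n)) n) (r : Vector Carrier n)
      (E₀ : ∀ i → ⟦ E i ⟧ᴷ (K.0# ◂ r) K.≈ K.0#)
      (inv : InvertibleMatrixᴷ (λ i j → ⟦ ∇ E i j ⟧ᴷ ⟨ K.0# , r , r ⟩)) where

      -- The chain rule yields coefficients in `K[x,y₀,y]`. As `y₀` is the constant tuple `r` for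
      -- every candidate solution, they may be turned into polynomials in `x` and `y` alone, as a
      -- differential equation for `y` requires.
      freeze : Poly (suc n ℕ.+ n) → Poly (suc n)
      freeze = substᵖ (var ⊕ (constᵖ ∘ r))

      ⟦freeze⟧ : ∀ p v → ⟦ freeze p ⟧ v ≈ ⟦ p ⟧ (v ⊕ (ι ∘ r))
      ⟦freeze⟧ p v = trans (⟦substᵖ⟧ (var ⊕ (constᵖ ∘ r)) p v) (⟦⟧-cong p pointwise)
        where
        pointwise : ∀ i → ⟦ (var ⊕ (constᵖ ∘ r)) i ⟧ v ≈ (v ⊕ (ι ∘ r)) i
        pointwise i with splitAt (suc n) i
        ... | inj₁ j = ⟦⟧-var v j
        ... | inj₂ j = ⟦⟧-const (r j) v

      embed : Poly (suc n) → Poly (suc (n ℕ.+ 1))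
      embed = substᵖ (var zero ◂ λ i → var (suc (i ↑ˡ 1)))

      ⟦embed⟧ : ∀ p ζ → ⟦ embed p ⟧ (𝕏 ◂ ζ) ≈ ⟦ p ⟧ (𝕏 ◂ λ i → ζ (i ↑ˡ 1))
      ⟦embed⟧ p ζ = trans (⟦substᵖ⟧ (var zero ◂ λ i → var (suc (i ↑ˡ 1))) p (𝕏 ◂ ζ)) (⟦⟧-cong p pointwise)
        where
        pointwise : ∀ i → ⟦ (var zero ◂ λ i → var (suc (i ↑ˡ 1))) i ⟧ (𝕏 ◂ ζ) ≈ (𝕏 ◂ λ i → ζ (i ↑ˡ 1)) i
        pointwise zero    = ⟦⟧-var (𝕏 ◂ ζ) zero
        pointwise (suc i) = ⟦⟧-var (𝕏 ◂ ζ) (suc (i ↑ˡ 1))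

      private
        A₀ B₀ : Vector (Vector Carrier n) n
        A₀ i j = ⟦ ∇ E i j ⟧ᴷ ⟨ K.0# , r , r ⟩
        B₀ = proj₁ inv

        module P where
          open CommutativeRing (polyRing (suc n)) public
          open MatrixProperties (polyRing (suc n)) public

      𝐀ᵖ : P.Matrix n
      𝐀ᵖ i j = freeze (∇ E i j)

      -- This is the value at `(0,r)`, since `η` sends `𝕏` to 0 and fixes constants. Kept inside
      -- `A`, it is a composite of two homomorphisms already at hand.
      h : Poly (suc n) → A
      h p = η (⟦ p ⟧ (𝕏 ◂ (ι ∘ r)))

      h-isRingHomomorphism : IsRingHomomorphism (polyRawRing (suc n)) rawRing h
      h-isRingHomomorphism = Algebra.Morphism.Construct.Composition.isRingHomomorphism trans
        (⟦⟧-isRingHomomorphism (𝕏 ◂ (ι ∘ r))) η-isRingHomomorphism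

      η-assignment : ∀ {y} → (∀ i → η (y i) ≈ ι (r i)) → ∀ i → η ((𝕏 ◂ y) i) ≈ ι ((K.0# ◂ r) i)
      η-assignment η-y zero    = trans η-𝕏 (sym ι.0#-homo)
      η-assignment η-y (suc i) = η-y i

      η-⟦⟧ : ∀ p {y} → (∀ i → η (y i) ≈ ι (r i)) → η (⟦ p ⟧ (𝕏 ◂ y)) ≈ ι (⟦ p ⟧ᴷ (K.0# ◂ r))
      η-⟦⟧ p {y} η-y = begin
        η (⟦ p ⟧ (𝕏 ◂ y))            ≈⟨ ⟦⟧-η p (𝕏 ◂ y) ⟩
        ⟦ p ⟧ (η ∘ (𝕏 ◂ y))          ≈⟨ ⟦⟧-cong p (η-assignment η-y) ⟩
        ⟦ p ⟧ (ι ∘ (K.0# ◂ r))       ≈⟨ ⟦⟧-ι p (K.0# ◂ r) ⟨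
        ι (⟦ p ⟧ᴷ (K.0# ◂ r))        ∎

      h-𝐀ᵖ : ∀ i j → h (𝐀ᵖ i j) ≈ ι (A₀ i j)
      h-𝐀ᵖ i j = begin
        η (⟦ freeze (∇ E i j) ⟧ (𝕏 ◂ (ι ∘ r)))               ≈⟨ η.⟦⟧-cong (⟦freeze⟧ (∇ E i j) (𝕏 ◂ (ι ∘ r))) ⟩
        η (⟦ ∇ E i j ⟧ ((𝕏 ◂ (ι ∘ r)) ⊕ (ι ∘ r)))            ≈⟨ ⟦⟧-η (∇ E i j) ((𝕏 ◂ (ι ∘ r)) ⊕ (ι ∘ r)) ⟩
        ⟦ ∇ E i j ⟧ (η ∘ ((𝕏 ◂ (ι ∘ r)) ⊕ (ι ∘ r)))          ≈⟨ ⟦⟧-cong (∇ E i j) pointwise ⟩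
        ⟦ ∇ E i j ⟧ (ι ∘ ⟨ K.0# , r , r ⟩)                   ≈⟨ ⟦⟧-ι (∇ E i j) ⟨ K.0# , r , r ⟩ ⟨
        ι (A₀ i j)                                           ∎
        where
        pointwise : ∀ i → η (((𝕏 ◂ (ι ∘ r)) ⊕ (ι ∘ r)) i) ≈ ι (⟨ K.0# , r , r ⟩ i)
        pointwise i with splitAt (suc n) i
        ... | inj₁ j = η-assignment (λ k → η-ι (r k)) j
        ... | inj₂ j = η-ι (r j)

      const-inverse : ((λ i j → constᵖ (A₀ i j)) P.*ᴹ (λ i j → constᵖ (B₀ i j))) P.≈ᴹ P.1ᴹ
      const-inverse i j ρ = begin
        ⟦ ((λ i j → constᵖ (A₀ i j)) P.*ᴹ (λ i j → constᵖ (B₀ i j))) i j ⟧ ρ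
          ≈⟨ Ev.*ᴹ-homo (λ i j → constᵖ (A₀ i j)) (λ i j → constᵖ (B₀ i j)) i j ⟩
        ((λ i j → ⟦ constᵖ (A₀ i j) ⟧ ρ) *ᴹ (λ i j → ⟦ constᵖ (B₀ i j) ⟧ ρ)) i j
          ≈⟨ *ⱽ-cong {N = λ i j → ι (A₀ i j)} (λ i j → ⟦⟧-const (A₀ i j) ρ) (λ k → ⟦⟧-const (B₀ k j) ρ) i ⟩
        ((λ i j → ι (A₀ i j)) *ᴹ (λ i j → ι (B₀ i j))) i j
          ≈⟨ Elimination.*ᴹ-homo-1ᴹ fieldRing S ι-isRingHomomorphism {M = A₀} {B₀} (proj₂ (proj₂ inv)) i j ⟩
        1ᴹ i j
          ≈⟨ Ev.1ᴹ-homo i j ⟨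
        ⟦ P.1ᴹ i j ⟧ ρ ∎
        where module Ev = Elimination (polyRing (suc n)) S (⟦⟧-isRingHomomorphism ρ)

      h-inverse : ((λ i j → h (constᵖ (B₀ i j))) *ᴹ (λ i j → h (𝐀ᵖ i j))) ≈ᴹ 1ᴹ
      h-inverse i j = begin
        ((λ i j → h (constᵖ (B₀ i j))) *ᴹ (λ i j → h (𝐀ᵖ i j))) i j
          ≈⟨ *ⱽ-cong {N = λ i j → ι (B₀ i j)} (λ i j → trans (η.⟦⟧-cong (⟦⟧-const (B₀ i j) (𝕏 ◂ (ι ∘ r)))) (η-ι (B₀ i j))) (λ k → h-𝐀ᵖ k j) i ⟩
        ((λ i j → ι (B₀ i j)) *ᴹ (λ i j → ι (A₀ i j))) i j
          ≈⟨ Elimination.*ᴹ-homo-1ᴹ fieldRing S ι-isRingHomomorphism {M = B₀} {A₀} (proj₁ (proj₂ inv)) i j ⟩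
        1ᴹ i j ∎

      abstract
        -- Kept abstract because only the scaled inverse property and the value of `d` under `h` are
        -- used from here on, never the polynomials that the elimination produces.
        adjugate : Σ[ N ∈ P.Matrix n ] Σ[ d ∈ Poly (suc n) ] P.IsScaledInverse 𝐀ᵖ d N × h d ≈ 1#
        adjugate = Elimination.invertible⇒scaledInverse (polyRing (suc n)) S h-isRingHomomorphism
          {A = 𝐀ᵖ} {λ i j → constᵖ (A₀ i j)} {λ i j → constᵖ (B₀ i j)} const-inverse h-inverse

      N : P.Matrix n
      N = proj₁ adjugate

      d : Poly (suc n)
      d = proj₁ (proj₂ adjugate)

      Pʸ : Vector (Poly (suc (n ℕ.+ 1))) n
      Pʸ i = -ᵖ (var (suc (n ↑ʳ zero)) *ᵖ embed ((N P.*ⱽ (ð/ðx ∘ E)) i))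

      -- The derivatives of `y` that the chain rule brings into the derivative of `d` are replaced
      -- by their right-hand sides `Pʸ i`, so that a polynomial in `x`, `y` and `w` results.
      Pʷ : Poly (suc (n ℕ.+ 1))
      Pʷ = -ᵖ (var (suc (n ↑ʳ zero)) *ᵖ (embed (ð/ðx d) +ᵖ sumᵖ (λ i → embed (freeze (ð/ðy i d)) *ᵖ Pʸ i)))
        where open Algebra.Properties.Semiring.Sum (CommutativeRing.semiring (polyRing (suc (n ℕ.+ 1)))) using () renaming (sum to sumᵖ)

      P : Vector (Poly (suc (n ℕ.+ 1))) (n ℕ.+ 1)
      P = Pʸ ⊕ (Pʷ ◂ ∅)

      initials : Vector Carrier (n ℕ.+ 1)
      initials = r ⊕ (K.1# ◂ ∅)

      module _ (y : Vector A n) where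
        𝐀 𝐍 : Matrix n
        𝐀 i j = ⟦ ∇ E i j ⟧ ⟨ 𝕏 , ι ∘ r , y ⟩
        𝐍 i j = ⟦ N i j ⟧ (𝕏 ◂ y)

        𝐝 : A
        𝐝 = ⟦ d ⟧ (𝕏 ◂ y)

        q : Vector A n
        q k = ⟦ ð/ðx (E k) ⟧ (𝕏 ◂ y)

      module WithInitialValue (y : Vector A n) (η-y : ∀ i → η (y i) ≈ ι (r i)) where
        private
          v : Vector A (suc n)
          v = 𝕏 ◂ y
          𝐀ʸ 𝐍ʸ : Matrix n
          𝐀ʸ = 𝐀 y
          𝐍ʸ = 𝐍 y
          𝐝ʸ : A
          𝐝ʸ = 𝐝 y
          qʸ : Vector A n
          qʸ = q y

        𝐀𝐍-scaled : IsScaledInverse 𝐀ʸ 𝐝ʸ 𝐍ʸ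
        𝐀𝐍-scaled = scaledInverse-cong {M = λ i j → ⟦ 𝐀ᵖ i j ⟧ v} {N = 𝐍ʸ} (λ i j → ⟦freeze⟧ (∇ E i j) v)
          (Elimination.scaledInverse-homo (polyRing (suc n)) S (⟦⟧-isRingHomomorphism v) {M = 𝐀ᵖ} {N} {d} (proj₁ (proj₂ (proj₂ adjugate))))

        -- The initial value of a polynomial in `𝕏` and `y` depends on `y` only through its initial
        -- value, so it may be computed at the constant tuple `r`, where it is `h d`.
        η-𝐝 : η 𝐝ʸ ≈ 1#
        η-𝐝 = begin
          η (⟦ d ⟧ v)                 ≈⟨ η-⟦⟧ d η-y ⟩
          ι (⟦ d ⟧ᴷ (K.0# ◂ r))       ≈⟨ η-⟦⟧ d (η-ι ∘ r) ⟨
          h d                         ≈⟨ proj₂ (proj₂ (proj₂ adjugate)) ⟩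
          1#                          ∎

        D-⟦⟧ : ∀ p → D (⟦ p ⟧ v) ≈ ⟦ ð/ðx p ⟧ v + sum (λ i → ⟦ ð/ðy i p ⟧ (v ⊕ (ι ∘ r)) * D (y i))
        D-⟦⟧ p = trans (chainRule y p) (+-congˡ (sum-cong-≋ λ i → *-congʳ (⟦⟧-cong (ð/ðy i p) pointwise)))
          where
          pointwise : ∀ i → (v ⊕ (η ∘ y)) i ≈ (v ⊕ (ι ∘ r)) i
          pointwise i with splitAt (suc n) i
          ... | inj₁ j = refl
          ... | inj₂ j = η-y j

        module _ (w : A) (w𝐝≈1 : w * 𝐝ʸ ≈ 1#) where

          𝐀-inverse : InvertibleMatrix 𝐀ʸ
          𝐀-inverse = (w ·ᴹ 𝐍ʸ) , scaledInverse-invertible {M = 𝐀ʸ} {𝐍ʸ} w w𝐝≈1 𝐀𝐍-scaled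

          solves-E : (∀ i → D (y i) ≈ - ((w ·ᴹ 𝐍ʸ) *ⱽ qʸ) i) → ∀ k → ⟦ E k ⟧ v ≈ 0#
          -- With both coefficients zero, `affine-unique` says that a stream is determined by its
          -- derivative and its initial value; here it compares `E k` along `y` with 0. The initial
          -- value vanishes by `E₀`.
          solves-E Dy k = affine-unique 0# 0#
            (trans (η-⟦⟧ (E k) η-y) (trans (ι.⟦⟧-cong (E₀ k)) (trans ι.0#-homo (sym η.0#-homo))))
            (trans DE≈0 (sym (trans (+-identityʳ _) (zeroˡ _)))) (trans D-0 (sym (trans (+-identityʳ _) (zeroˡ _))))
            where
            DE≈0 : D (⟦ E k ⟧ v) ≈ 0#
            DE≈0 = begin
              D (⟦ E k ⟧ v)                                       ≈⟨ D-⟦⟧ (E k) ⟩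
              qʸ k + (𝐀ʸ *ⱽ (D ∘ y)) k                              ≈⟨ +-congˡ (*ⱽ-cong {M = 𝐀ʸ} (λ _ _ → refl) Dy k) ⟩
              qʸ k + (𝐀ʸ *ⱽ (λ i → - ((w ·ᴹ 𝐍ʸ) *ⱽ qʸ) i)) k          ≈⟨ +-congˡ (*ⱽ-neg 𝐀ʸ ((w ·ᴹ 𝐍ʸ) *ⱽ qʸ) k) ⟩
              qʸ k - (𝐀ʸ *ⱽ ((w ·ᴹ 𝐍ʸ) *ⱽ qʸ)) k                      ≈⟨ +-congˡ (-‿cong (*ᴹ-*ⱽ 𝐀ʸ (w ·ᴹ 𝐍ʸ) qʸ k)) ⟨
              qʸ k - ((𝐀ʸ *ᴹ (w ·ᴹ 𝐍ʸ)) *ⱽ qʸ) k                      ≈⟨ +-congˡ (-‿cong (*ⱽ-cong {N = 1ᴹ} (proj₂ (proj₂ 𝐀-inverse)) (λ _ → refl) k)) ⟩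
              qʸ k - (1ᴹ *ⱽ qʸ) k                                   ≈⟨ +-congˡ (-‿cong (1ᴹ-*ⱽ qʸ k)) ⟩
              qʸ k - qʸ k                                           ≈⟨ -‿inverseʳ _ ⟩
              0#                                                  ∎

          -- Differentiating `E = 0` by the chain rule gives a linear system for the derivatives of
          -- `y`, which the inverse of the matrix solves.
          E-solution-D : (∀ k → ⟦ E k ⟧ v ≈ 0#) → ∀ i → D (y i) ≈ - ((w ·ᴹ 𝐍ʸ) *ⱽ qʸ) i
          E-solution-D sol i = begin
            D (y i)                                               ≈⟨ 1ᴹ-*ⱽ (D ∘ y) i ⟨
            (1ᴹ *ⱽ (D ∘ y)) i                                     ≈⟨ *ⱽ-cong {N = 1ᴹ} (proj₁ (proj₂ 𝐀-inverse)) (λ _ → refl) i ⟨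
            (((w ·ᴹ 𝐍ʸ) *ᴹ 𝐀ʸ) *ⱽ (D ∘ y)) i                        ≈⟨ *ᴹ-*ⱽ (w ·ᴹ 𝐍ʸ) 𝐀ʸ (D ∘ y) i ⟩
            ((w ·ᴹ 𝐍ʸ) *ⱽ (𝐀ʸ *ⱽ (D ∘ y))) i                        ≈⟨ *ⱽ-cong {M = w ·ᴹ 𝐍ʸ} (λ _ _ → refl) 𝐀Dy i ⟩
            ((w ·ᴹ 𝐍ʸ) *ⱽ (λ k → - qʸ k)) i                         ≈⟨ *ⱽ-neg (w ·ᴹ 𝐍ʸ) qʸ i ⟩
            - ((w ·ᴹ 𝐍ʸ) *ⱽ qʸ) i                                   ∎
            where
            𝐀Dy : ∀ k → (𝐀ʸ *ⱽ (D ∘ y)) k ≈ - qʸ k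
            𝐀Dy k = +-inverseʳ-unique (qʸ k) _ (trans (sym (D-⟦⟧ (E k))) (trans (D-cong (sol k)) D-0))

          η-inverse : η w ≈ 1#
          η-inverse = begin
            η w          ≈⟨ *-identityʳ _ ⟨
            η w * 1#     ≈⟨ *-congˡ η-𝐝 ⟨
            η w * η 𝐝ʸ   ≈⟨ η.*-homo w 𝐝ʸ ⟨
            η (w * 𝐝ʸ)   ≈⟨ η.⟦⟧-cong w𝐝≈1 ⟩
            η 1#         ≈⟨ η.1#-homo ⟩
            1#           ∎

          D-inverse : D w ≈ - (w * D 𝐝ʸ)
          D-inverse = begin
            D w                  ≈⟨ *-identityʳ _ ⟨
            D w * 1#             ≈⟨ *-congˡ w𝐝≈1 ⟨
            D w * (w * 𝐝ʸ)        ≈⟨ x∙yz≈y∙xz _ _ _ ⟩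
            w * (D w * 𝐝ʸ)        ≈⟨ *-congˡ (+-inverseˡ-unique _ _ product-rule) ⟩
            w * - D 𝐝ʸ            ≈⟨ -‿distribʳ-* _ _ ⟨
            - (w * D 𝐝ʸ)          ∎
            where
            open Algebra.Properties.Ring ring using (+-inverseˡ-unique)
            product-rule : D w * 𝐝ʸ + D 𝐝ʸ ≈ 0#
            product-rule = begin
              D w * 𝐝ʸ + D 𝐝ʸ           ≈⟨ +-congˡ (trans (*-congʳ (η-inverse)) (*-identityˡ _)) ⟨
              D w * 𝐝ʸ + η w * D 𝐝ʸ     ≈⟨ D-* w 𝐝ʸ ⟨
              D (w * 𝐝ʸ)               ≈⟨ trans (D-cong w𝐝≈1) D-1 ⟩
              0#                      ∎

        D-inverse⇒inverse : ∀ w → η w ≈ 1# → D w ≈ - (w * D 𝐝ʸ) → w * 𝐝ʸ ≈ 1#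
        D-inverse⇒inverse w ηw Dw = affine-unique (- D 𝐝ʸ) (D 𝐝ʸ)
          (trans (η.*-homo w 𝐝ʸ) (trans (*-cong ηw η-𝐝) (trans (*-identityˡ _) (sym η.1#-homo))))
          D-w𝐝 (trans D-1 (sym (trans (+-congʳ (*-identityʳ _)) (-‿inverseˡ _))))
          where
          D-w𝐝 : D (w * 𝐝ʸ) ≈ - D 𝐝ʸ * (w * 𝐝ʸ) + D 𝐝ʸ
          D-w𝐝 = begin
            D (w * 𝐝ʸ)                      ≈⟨ D-* w 𝐝ʸ ⟩
            D w * 𝐝ʸ + η w * D 𝐝ʸ            ≈⟨ +-cong (*-congʳ Dw) (trans (*-congʳ ηw) (*-identityˡ _)) ⟩
            - (w * D 𝐝ʸ) * 𝐝ʸ + D 𝐝ʸ          ≈⟨ +-congʳ (trans (*-congʳ (trans (-‿cong (*-comm _ _)) (-‿distribˡ-* _ _))) (*-assoc _ _ _)) ⟩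
            - D 𝐝ʸ * (w * 𝐝ʸ) + D 𝐝ʸ          ∎

      module _ (ζ : Vector A (n ℕ.+ 1)) where
        yᶻ : Vector A n
        yᶻ i = ζ (i ↑ˡ 1)

        wᶻ : A
        wᶻ = ζ (n ↑ʳ zero)

        ⟦Pʸ⟧ : ∀ i → ⟦ Pʸ i ⟧ (𝕏 ◂ ζ) ≈ - ((wᶻ ·ᴹ 𝐍 yᶻ) *ⱽ q yᶻ) i
        ⟦Pʸ⟧ i = begin
          ⟦ Pʸ i ⟧ (𝕏 ◂ ζ)
            ≈⟨ ⟦⟧-neg (var (suc (n ↑ʳ zero)) *ᵖ embed Q) (𝕏 ◂ ζ) ⟩
          - ⟦ var (suc (n ↑ʳ zero)) *ᵖ embed Q ⟧ (𝕏 ◂ ζ)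
            ≈⟨ -‿cong (⟦⟧-* (var (suc (n ↑ʳ zero))) (embed Q) (𝕏 ◂ ζ)) ⟩
          - (⟦ var (suc (n ↑ʳ zero)) ⟧ (𝕏 ◂ ζ) * ⟦ embed Q ⟧ (𝕏 ◂ ζ))
            ≈⟨ -‿cong (*-cong (⟦⟧-var (𝕏 ◂ ζ) (suc (n ↑ʳ zero))) (⟦embed⟧ Q ζ)) ⟩
          - (wᶻ * ⟦ Q ⟧ (𝕏 ◂ yᶻ))
            ≈⟨ -‿cong (*-congˡ (trans (Ev.sum-homo (λ k → N i k *ᵖ ð/ðx (E k))) (sum-cong-≋ λ k → ⟦⟧-* (N i k) (ð/ðx (E k)) (𝕏 ◂ yᶻ)))) ⟩
          - (wᶻ * (𝐍 yᶻ *ⱽ q yᶻ) i)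
            ≈⟨ -‿cong (·ᴹ-*ⱽ wᶻ (𝐍 yᶻ) (q yᶻ) i) ⟨
          - ((wᶻ ·ᴹ 𝐍 yᶻ) *ⱽ q yᶻ) i ∎
          where
          module Ev = Elimination (polyRing (suc n)) S (⟦⟧-isRingHomomorphism (𝕏 ◂ yᶻ))
          Q : Poly (suc n)
          Q = (N P.*ⱽ (ð/ðx ∘ E)) i

        ⟦Pʷ⟧ : ⟦ Pʷ ⟧ (𝕏 ◂ ζ) ≈
          - (wᶻ * (⟦ ð/ðx d ⟧ (𝕏 ◂ yᶻ) + sum (λ i → ⟦ ð/ðy i d ⟧ ((𝕏 ◂ yᶻ) ⊕ (ι ∘ r)) * ⟦ Pʸ i ⟧ (𝕏 ◂ ζ))))
        ⟦Pʷ⟧ = begin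
          ⟦ Pʷ ⟧ (𝕏 ◂ ζ)
            ≈⟨ ⟦⟧-neg (var (suc (n ↑ʳ zero)) *ᵖ D-dᵖ) (𝕏 ◂ ζ) ⟩
          - ⟦ var (suc (n ↑ʳ zero)) *ᵖ D-dᵖ ⟧ (𝕏 ◂ ζ)
            ≈⟨ -‿cong (⟦⟧-* (var (suc (n ↑ʳ zero))) D-dᵖ (𝕏 ◂ ζ)) ⟩
          - (⟦ var (suc (n ↑ʳ zero)) ⟧ (𝕏 ◂ ζ) * ⟦ D-dᵖ ⟧ (𝕏 ◂ ζ))
            ≈⟨ -‿cong (*-cong (⟦⟧-var (𝕏 ◂ ζ) (suc (n ↑ʳ zero))) (⟦⟧-+ (embed (ð/ðx d)) (sumᵖ linear) (𝕏 ◂ ζ))) ⟩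
          - (wᶻ * (⟦ embed (ð/ðx d) ⟧ (𝕏 ◂ ζ) + ⟦ sumᵖ linear ⟧ (𝕏 ◂ ζ)))
            ≈⟨ -‿cong (*-congˡ (+-cong (⟦embed⟧ (ð/ðx d) ζ) (trans (Ev.sum-homo linear) (sum-cong-≋ term)))) ⟩
          - (wᶻ * (⟦ ð/ðx d ⟧ (𝕏 ◂ yᶻ) + sum (λ i → ⟦ ð/ðy i d ⟧ ((𝕏 ◂ yᶻ) ⊕ (ι ∘ r)) * ⟦ Pʸ i ⟧ (𝕏 ◂ ζ)))) ∎
          where
          module Ev = Elimination (polyRing (suc (n ℕ.+ 1))) S (⟦⟧-isRingHomomorphism (𝕏 ◂ ζ))
          open Algebra.Properties.Semiring.Sum (CommutativeRing.semiring (polyRing (suc (n ℕ.+ 1)))) using () renaming (sum to sumᵖ)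
          linear : Vector (Poly (suc (n ℕ.+ 1))) n
          linear i = embed (freeze (ð/ðy i d)) *ᵖ Pʸ i
          D-dᵖ : Poly (suc (n ℕ.+ 1))
          D-dᵖ = embed (ð/ðx d) +ᵖ sumᵖ linear
          term : ∀ i → ⟦ linear i ⟧ (𝕏 ◂ ζ) ≈ ⟦ ð/ðy i d ⟧ ((𝕏 ◂ yᶻ) ⊕ (ι ∘ r)) * ⟦ Pʸ i ⟧ (𝕏 ◂ ζ)
          term i = trans (⟦⟧-* (embed (freeze (ð/ðy i d))) (Pʸ i) (𝕏 ◂ ζ))
            (*-congʳ (trans (⟦embed⟧ (freeze (ð/ðy i d)) ζ) (⟦freeze⟧ (ð/ðy i d) (𝕏 ◂ yᶻ))))

        -- `Pʷ` has `r` and `Pʸ` built in, so it computes the derivative of `d` only along tuples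
        -- that start at `r` and already satisfy the equations for `y`.
        ⟦Pʷ⟧-D𝐝 : (∀ i → η (yᶻ i) ≈ ι (r i)) → (∀ i → D (yᶻ i) ≈ ⟦ Pʸ i ⟧ (𝕏 ◂ ζ)) →
          ⟦ Pʷ ⟧ (𝕏 ◂ ζ) ≈ - (wᶻ * D (𝐝 yᶻ))
        ⟦Pʷ⟧-D𝐝 η-y D-y = trans ⟦Pʷ⟧ (-‿cong (*-congˡ (sym (trans (D-⟦⟧ d)
          (+-congˡ (sum-cong-≋ λ i → *-congˡ (D-y i)))))))
          where open WithInitialValue yᶻ η-y

        P-ˡ : ∀ i → ⟦ P (i ↑ˡ 1) ⟧ (𝕏 ◂ ζ) ≡ ⟦ Pʸ i ⟧ (𝕏 ◂ ζ)
        P-ˡ i = ≡.cong (λ p → ⟦ p ⟧ (𝕏 ◂ ζ)) (lookup-++ˡ Pʸ (Pʷ ◂ ∅) i)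

        P-ʳ : ⟦ P (n ↑ʳ zero) ⟧ (𝕏 ◂ ζ) ≡ ⟦ Pʷ ⟧ (𝕏 ◂ ζ)
        P-ʳ = ≡.cong (λ p → ⟦ p ⟧ (𝕏 ◂ ζ)) (lookup-++ʳ Pʸ (Pʷ ◂ ∅) zero)

        -- The relation between `w` and `d` has to come first: `solves-E` needs the inverse of the
        -- matrix, which is available only once `w` is known to be the reciprocal of `d`.
        solvesIVP⇒solves-E : SolvesIVP P initials ζ →
          (∀ i → η (yᶻ i) ≈ ι (r i)) × (∀ k → ⟦ E k ⟧ (𝕏 ◂ yᶻ) ≈ 0#) × wᶻ * 𝐝 yᶻ ≈ 1#
        solvesIVP⇒solves-E (D-ζ , η-ζ) = η-y , solves-E wᶻ w𝐝≈1 (λ i → trans (D-y i) (⟦Pʸ⟧ i)) , w𝐝≈1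
          where
          η-y : ∀ i → η (yᶻ i) ≈ ι (r i)
          η-y i = trans (η-ζ (i ↑ˡ 1)) (reflexive (≡.cong ι (lookup-++ˡ r (K.1# ◂ ∅) i)))
          open WithInitialValue yᶻ η-y
          D-y : ∀ i → D (yᶻ i) ≈ ⟦ Pʸ i ⟧ (𝕏 ◂ ζ)
          D-y i = trans (D-ζ (i ↑ˡ 1)) (reflexive (P-ˡ i))
          w𝐝≈1 : wᶻ * 𝐝 yᶻ ≈ 1#
          w𝐝≈1 = D-inverse⇒inverse wᶻ
            (trans (η-ζ (n ↑ʳ zero)) (trans (reflexive (≡.cong ι (lookup-++ʳ r (K.1# ◂ ∅) zero))) ι.1#-homo))
            (trans (D-ζ (n ↑ʳ zero)) (trans (reflexive P-ʳ) (⟦Pʷ⟧-D𝐝 η-y D-y)))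

        solves-E⇒solvesIVP : (∀ i → η (yᶻ i) ≈ ι (r i)) → (∀ k → ⟦ E k ⟧ (𝕏 ◂ yᶻ) ≈ 0#) → wᶻ * 𝐝 yᶻ ≈ 1# → SolvesIVP P initials ζ
        solves-E⇒solvesIVP η-y sol w𝐝≈1 =
          ∀-↑ (λ i → trans (D-y i) (reflexive (≡.sym (P-ˡ i))))
              (λ { zero → trans (D-inverse wᶻ w𝐝≈1) (trans (sym (⟦Pʷ⟧-D𝐝 η-y D-y)) (reflexive (≡.sym P-ʳ))) }) ,
          ∀-↑ (λ i → trans (η-y i) (reflexive (≡.sym (≡.cong ι (lookup-++ˡ r (K.1# ◂ ∅) i)))))
              (λ { zero → trans (η-inverse wᶻ w𝐝≈1) (trans (sym ι.1#-homo) (reflexive (≡.sym (≡.cong ι (lookup-++ʳ r (K.1# ◂ ∅) zero))))) })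
          where
          open WithInitialValue yᶻ η-y
          D-y : ∀ i → D (yᶻ i) ≈ ⟦ Pʸ i ⟧ (𝕏 ◂ ζ)
          D-y i = trans (E-solution-D wᶻ w𝐝≈1 sol i) (sym (⟦Pʸ⟧ i))

      -- The reciprocal exists because `d` along `y` has initial value 1. This makes uniqueness for
      -- the initial value problem applicable to every solution of `E` that starts at `r`.
      extend : ∀ y → (∀ i → η (y i) ≈ ι (r i)) → (∀ k → ⟦ E k ⟧ (𝕏 ◂ y) ≈ 0#) → ∃[ w ] SolvesIVP P initials (y ⊕ (w ◂ ∅))
      extend y η-y sol with inverse (𝐝 y) (WithInitialValue.η-𝐝 y η-y)
      ... | w , w𝐝≈1 = w , solves-E⇒solvesIVP ζ
        (λ i → trans (reflexive (≡.cong η (lookup-++ˡ y (w ◂ ∅) i))) (η-y i))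
        (λ k → trans (⟦⟧-cong (E k) same) (sol k))
        (trans (*-cong (reflexive (lookup-++ʳ y (w ◂ ∅) zero)) (⟦⟧-cong d same)) w𝐝≈1)
        where
        ζ : Vector A (n ℕ.+ 1)
        ζ = y ⊕ (w ◂ ∅)
        same : ∀ i → (𝕏 ◂ (λ i → ζ (i ↑ˡ 1))) i ≈ (𝕏 ◂ y) i
        same zero    = refl
        same (suc i) = reflexive (lookup-++ˡ y (w ◂ ∅) i)

      private
        ζ : Vector A (n ℕ.+ 1)
        ζ = proj₁ (ivp-solvable P initials)

        ζ-ivp : SolvesIVP P initials ζ
        ζ-ivp = proj₂ (ivp-solvable P initials)

        σ : Vector A n
        σ = yᶻ ζ

        w : A
        w = wᶻ ζ

        η-σ : ∀ i → η (σ i) ≈ ι (r i)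
        η-σ = proj₁ (solvesIVP⇒solves-E ζ ζ-ivp)

        σ-solves : ∀ k → ⟦ E k ⟧ (𝕏 ◂ σ) ≈ 0#
        σ-solves = proj₁ (proj₂ (solvesIVP⇒solves-E ζ ζ-ivp))

        w𝐝≈1 : w * 𝐝 σ ≈ 1#
        w𝐝≈1 = proj₂ (proj₂ (solvesIVP⇒solves-E ζ ζ-ivp))

        -- The solution `ζ` agrees with `σ ⊕ (w ◂ ∅)` only pointwise, whereas the conclusion asks
        -- for a tuple of exactly this form. Extending `σ` afresh provides one; its last component
        -- equals `w` by uniqueness.
        τ : A
        τ = proj₁ (extend σ η-σ σ-solves)

        στ-ivp : SolvesIVP P initials (σ ⊕ (τ ◂ ∅))
        στ-ivp = proj₂ (extend σ η-σ σ-solves)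

        σ-unique : ∀ ρ → (∀ k → ⟦ E k ⟧ (𝕏 ◂ ρ) ≈ 0#) → (∀ i → η (ρ i) ≈ ι (r i)) → ∀ i → ρ i ≈ σ i
        σ-unique ρ sol η-ρ i = trans (reflexive (≡.sym (lookup-++ˡ ρ (proj₁ ρw ◂ ∅) i)))
          (ivp-unique P initials {ρ ⊕ (proj₁ ρw ◂ ∅)} {ζ} (proj₂ ρw) ζ-ivp (i ↑ˡ 1))
          where
          ρw : ∃[ w ] SolvesIVP P initials (ρ ⊕ (w ◂ ∅))
          ρw = extend ρ η-ρ sol

      abstract
        implicitFunction : Σ[ σ ∈ Vector A n ]
          ((∀ k → ⟦ E k ⟧ (𝕏 ◂ σ) ≈ 0#) × (∀ i → η (σ i) ≈ ι (r i))) ×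
          (∀ ρ → (∀ k → ⟦ E k ⟧ (𝕏 ◂ ρ) ≈ 0#) → (∀ i → η (ρ i) ≈ ι (r i)) → ∀ i → ρ i ≈ σ i) ×
          (Σ[ 𝐀⁻¹ ∈ InvertibleMatrix (𝐀 σ) ] (∀ i → D (σ i) ≈ - (proj₁ 𝐀⁻¹ *ⱽ q σ) i)) ×
          (Σ[ P ∈ Vector (Poly (suc (n ℕ.+ 1))) (n ℕ.+ 1) ] Σ[ w₀ ∈ Carrier ] Σ[ τ ∈ A ]
            SolvesIVP P (r ⊕ (w₀ ◂ ∅)) (σ ⊕ (τ ◂ ∅)) ×
            (∀ ρ → SolvesIVP P (r ⊕ (w₀ ◂ ∅)) ρ → ∀ i → ρ i ≈ (σ ⊕ (τ ◂ ∅)) i))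
        implicitFunction =
          σ , (σ-solves , η-σ) , σ-unique ,
          (WithInitialValue.𝐀-inverse σ η-σ w w𝐝≈1 , WithInitialValue.E-solution-D σ η-σ w w𝐝≈1 σ-solves) ,
          P , K.1# , τ , στ-ivp , λ ρ ρ-ivp → ivp-unique P initials {ρ} {σ ⊕ (τ ◂ ∅)} ρ-ivp στ-ivp

-- The theorem for the concrete ring of streams.

open import Data.Nat.Base using (_+_)
open import Data.Vec.Functional using ([]; _∷_; _++_)

theorem3p7 : ∀ {c ℓ₁ ℓ₂} (K : HeytingField c ℓ₁ ℓ₂) → CharacteristicZero K →
    let open StreamCalculus K in
    (n : ℕ) (E : Vector (Poly (suc n)) n) (r₀ : Vector Carrier n) →
    (∀ i → ⟦ E i ⟧ᴷ (0# ∷ r₀) ≈ 0#) →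
    InvertibleMatrixᴷ (λ i j → ⟦ ∇ E i j ⟧ᴷ ⟨ 0# , r₀ , r₀ ⟩) →
    Σ[ σ ∈ Vector Stream n ]
    (IsStreamSolution E σ × HasInitialValue σ r₀) ×
    (∀ ρ → IsStreamSolution E ρ → HasInitialValue ρ r₀ → ρ ≈ˢⱽ σ) ×
    (Σ[ inv ∈ InvertibleMatrixˢ (λ i j → ⟦ ∇ E i j ⟧ˢ ⟨ X , (λ k → const (r₀ k)) , σ ⟩) ]
    (∀ i → (σ i ′) ≈ˢ (-ˢ (proj₁ inv *ˢⱽ (λ k → ⟦ ð/ðx (E k) ⟧ˢ (X ∷ σ))) i))) ×
    (Σ[ P ∈ Vector (Poly (suc (n + 1))) (n + 1) ] Σ[ w₀ ∈ Carrier ] Σ[ τ ∈ Stream ]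
    IsIVPSolution P (r₀ ++ (w₀ ∷ [])) (σ ++ (τ ∷ [])) ×
    (∀ ρ → IsIVPSolution P (r₀ ++ (w₀ ∷ [])) ρ → ρ ≈ˢⱽ (σ ++ (τ ∷ []))))
theorem3p7 K _ n E r₀ E₀ inv =
  let σ , (σ-solves , η-σ) , σ-unique , σ′≈ , P , w₀ , τ , (D-στ , η-στ) , στ-unique = implicitFunction E r₀ E₀ inv in
  -- The abstract theorem states initial conditions between constant streams: reading entry 0 yields
  -- the equations in `K`, and `const-cong` leads back.
  σ , (σ-solves , λ i → η-σ i 0) ,
  (λ ρ sol init → σ-unique ρ sol (λ i → const-cong (init i))) ,
  σ′≈ ,
  P , w₀ , τ , (D-στ , λ i → η-στ i 0) ,
  λ ρ (D-ρ , init) → στ-unique ρ (D-ρ , λ i → const-cong (init i))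
  where
  open StreamTheory K
  open Streams using (streamAlgebra; const-cong)
  open ImplicitFunction streamAlgebra using (implicitFunction)
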